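{- Let $W$ be one of the Coxeter groups $A_{n-1}$, i.e. the symmetric group $S_n$ with generating set $S=\{(i,i+1)\mid i=1,\dots,n-1\}$, let $p$ be a prime, and let $K\in E$, $L\in F$. Then $d_{KL}=1$ if and only if $c_K$ and $c_L$ have conjugate $p$-regular parts (conjugate in $W$).
   Context: For $J\subseteq S$, $W_J=\langle J\rangle$ and $c_J$ is a Coxeter element of $W_J$ (the product of the elements of $J$ in some order). $E$ is a set of representatives of the $W$-conjugacy classes of subsets of $S$. For $J,K\subseteq S$, $\beta_{JK}$ is the number of fixed points of $W_K$ on the coset space $W/W_J$; $M^c(W)=(\beta_{JK})_{J,K\in E}$ is the parabolic table of marks. For a prime $p$, $F\subseteq E$ is the set of $J\in E$ whose row of $M^c(W)$ is non-zero modulo $p$ (equivalently, $p\nmid [N_W(W_J):W_J]$). For $K\in E$, $L\in F$, $d_{KL}=1$ if columns $K$ and $L$ of $M^c(W)$ are equal modulo $p$, and $d_{KL}=0$ otherwise; $D=(d_{KL})$ is the decomposition matrix of the descent algebra $\Sigma_W$ modulo $p$. The $p$-regular part of $w\in W$ is the element $w'$ in the unique factorization $w=w'w''=w''w'$ with $w'$ of order prime to $p$ and $w''$ of $p$-power order. -}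

module Defs where

open import Level using (0ℓ)
open import Algebra.Bundles using (Group)
import Algebra.Definitions.RawMonoid as RawMonoidDefs
import Algebra.Properties.Group as GroupProperties
open import Data.Bool.Base using (if_then_else_)
open import Data.Fin.Base using (Fin; zero; suc; inject₁; punchIn)
open import Data.Fin.Patterns using (0F)
open import Data.Fin.Permutation as Perm using (Permutation′; _⟨$⟩ʳ_; _⟨$⟩ˡ_; _∘ₚ_; flip; transpose; insert; remove; insert-remove)
import Data.Fin.Properties as Fin
open import Data.Fin.Subset using (Subset) renaming (_∈_ to _∈ₛ_)
open import Data.Fin.Subset.Properties using () renaming (_∈?_ to _∈ₛ?_)
open import Data.List.Base using (List; []; _∷_; [_]; allFin; cartesianProductWith; deduplicate; filter; foldr; length; map)
import Data.List.Membership.Propositional as ListMem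
import Data.List.Membership.Propositional.Properties as ListMemₚ
import Data.List.Membership.Setoid as SetoidMem
open import Data.List.Membership.Setoid.Properties using (∈-resp-≈; ∈-cartesianProductWith⁺)
open import Data.List.Relation.Unary.All using (All; all?)
import Data.List.Relation.Unary.All as All
open import Data.List.Relation.Unary.AllPairs using (AllPairs)
open import Data.List.Relation.Unary.Any using (Any; any?; here; there)
open import Data.List.Relation.Unary.Enumerates.Setoid using (IsEnumeration)
open import Data.List.Relation.Unary.Unique.Propositional using (Unique)
open import Data.Nat.Base as ℕ using (ℕ; zero; suc; ∣_-_∣; NonZero)
open import Data.Nat.Coprimality using (Coprime)
open import Data.Nat.Divisibility using (_∣_; _∣?_)
open import Data.Product.Base using (∃; ∃₂; _×_; _,_)
open import Data.Sum.Base using (_⊎_; inj₁; inj₂)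
open import Function.Bundles using (_⇔_)
open import Relation.Binary.Core using (Rel)
import Relation.Binary.Definitions as B
open import Relation.Binary.PropositionalEquality.Core as ≡ using (_≡_; refl)
open import Relation.Binary.PropositionalEquality.Properties using (setoid)
open import Relation.Nullary using (Dec; does; ¬_; ¬?; _×-dec_; _⊎-dec_; _→-dec_)
open import Relation.Nullary.Decidable using (map′)
open import Relation.Unary using (Pred; Decidable)

module GroupTheory (G : Group 0ℓ 0ℓ) where
  open Group G
  open RawMonoidDefs rawMonoid using () renaming (_×_ to _times_)

  infixl 8 _^_
  _^_ : Carrier → ℕ → Carrier
  x ^ k = k times x

  data ⟨_⟩ (X : Pred Carrier 0ℓ) : Pred Carrier 0ℓ where
    gen  : ∀ {x} → X x → ⟨ X ⟩ x
    one  : ⟨ X ⟩ ε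
    mul  : ∀ {x y} → ⟨ X ⟩ x → ⟨ X ⟩ y → ⟨ X ⟩ (x ∙ y)
    inv  : ∀ {x} → ⟨ X ⟩ x → ⟨ X ⟩ (x ⁻¹)
    resp : ∀ {x y} → x ≈ y → ⟨ X ⟩ x → ⟨ X ⟩ y

  Conjugate : Rel Carrier 0ℓ
  Conjugate x y = ∃ λ g → g ∙ x ∙ g ⁻¹ ≈ y

  ConjugateSets : Rel (Pred Carrier 0ℓ) 0ℓ
  ConjugateSets X Y = ∃ λ g → ∀ x → X x ⇔ Y (g ∙ x ∙ g ⁻¹)

  SameLeftCoset : Pred Carrier 0ℓ → Rel Carrier 0ℓ
  SameLeftCoset H x y = H (x ⁻¹ ∙ y)

  -- The coset x H is a fixed point of K acting on G / H by left
  -- multiplication.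
  FixesCoset : (K H : Pred Carrier 0ℓ) → Pred Carrier 0ℓ
  FixesCoset K H x = ∀ k → K k → SameLeftCoset H (k ∙ x) x

  record HasOrder (x : Carrier) (k : ℕ) : Set where
    field
      positive : NonZero k
      power    : x ^ k ≈ ε
      minimal  : ∀ j → NonZero j → x ^ j ≈ ε → k ℕ.≤ j

  IsRegularPart : (p : ℕ) → Rel Carrier 0ℓ
  IsRegularPart p w w′ = ∃ λ w″ →
      w ≈ w′ ∙ w″
    × w ≈ w″ ∙ w′
    × (∃ λ k → HasOrder w′ k × Coprime k p)
    × (∃ λ a → HasOrder w″ (p ℕ.^ a))

  ConjugateRegularParts : (p : ℕ) → Rel Carrier 0ℓ
  ConjugateRegularParts p x y = ∃₂ λ x′ y′ →
    IsRegularPart p x x′ × IsRegularPart p y y′ × Conjugate x′ y′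

module FiniteGroupTheory
  (G : Group 0ℓ 0ℓ)
  (_≟_ : B.Decidable (Group._≈_ G))
  (elements : List (Group.Carrier G))
  (complete : IsEnumeration (Group.setoid G) elements)
  where
  open Group G renaming (refl to ≈-refl; sym to ≈-sym; trans to ≈-trans)
  open GroupTheory G
  open SetoidMem (Group.setoid G) using (_∈_)

  ∀? : {P : Pred Carrier 0ℓ} → (∀ {x y} → x ≈ y → P x → P y) →
       Decidable P → Dec (∀ x → P x)
  ∀? P-resp P? = map′
    (λ all x → All.lookupWith (λ Py x≈y → P-resp (≈-sym x≈y) Py) all (complete x))
    (λ f → All.universal f elements)
    (all? P? elements)

  -- Membership in a generated subgroup is decided by reachability from ε
  -- in the Cayley graph: Path vs x y is a path from x to y all of whose
  -- interior vertices lie in vs.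

  module Membership
    {X : Pred Carrier 0ℓ}
    (X-resp : ∀ {x y} → x ≈ y → X x → X y)
    (X? : Decidable X)
    where
    open GroupProperties G

    private
      Edge : Rel Carrier 0ℓ
      Edge x y = x ≈ y ⊎ X (x ⁻¹ ∙ y) ⊎ X (y ⁻¹ ∙ x)

      Path : List Carrier → Rel Carrier 0ℓ
      Path []       x y = Edge x y
      Path (v ∷ vs) x y = Path vs x y ⊎ (Path vs x v × Path vs v y)

      path? : ∀ vs → B.Decidable (Path vs)
      path? []       x y = (x ≟ y) ⊎-dec (X? (x ⁻¹ ∙ y) ⊎-dec X? (y ⁻¹ ∙ x))
      path? (v ∷ vs) x y = path? vs x y ⊎-dec (path? vs x v ×-dec path? vs v y)

      path-resp : ∀ vs {x x′ y y′} → x ≈ x′ → y ≈ y′ → Path vs x y → Path vs x′ y′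
      path-resp [] p q (inj₁ e) = inj₁ (≈-trans (≈-sym p) (≈-trans e q))
      path-resp [] p q (inj₂ (inj₁ e)) = inj₂ (inj₁ (X-resp (∙-cong (⁻¹-cong p) q) e))
      path-resp [] p q (inj₂ (inj₂ e)) = inj₂ (inj₂ (X-resp (∙-cong (⁻¹-cong q) p) e))
      path-resp (v ∷ vs) p q (inj₁ e) = inj₁ (path-resp vs p q e)
      path-resp (v ∷ vs) p q (inj₂ (e , f)) =
        inj₂ (path-resp vs p ≈-refl e , path-resp vs ≈-refl q f)

      path-sym : ∀ vs {x y} → Path vs x y → Path vs y x
      path-sym [] (inj₁ e) = inj₁ (≈-sym e)
      path-sym [] (inj₂ (inj₁ e)) = inj₂ (inj₂ e)
      path-sym [] (inj₂ (inj₂ e)) = inj₂ (inj₁ e)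
      path-sym (v ∷ vs) (inj₁ e) = inj₁ (path-sym vs e)
      path-sym (v ∷ vs) (inj₂ (e , f)) = inj₂ (path-sym vs f , path-sym vs e)

      path-trans : ∀ vs {u x y} → u ∈ vs → Path vs x u → Path vs u y → Path vs x y
      path-trans (v ∷ vs) {u} {x} {y} (here u≈v) e f = inj₂ (left e , right f)
        where
        left : Path (v ∷ vs) x u → Path vs x v
        left (inj₁ e) = path-resp vs ≈-refl u≈v e
        left (inj₂ (e , _)) = e
        right : Path (v ∷ vs) u y → Path vs v y
        right (inj₁ f) = path-resp vs u≈v ≈-refl f
        right (inj₂ (_ , f)) = f
      path-trans (v ∷ vs) (there u∈) (inj₁ e) (inj₁ f) = inj₁ (path-trans vs u∈ e f)
      path-trans (v ∷ vs) (there u∈) (inj₁ e) (inj₂ (f , g)) = inj₂ (path-trans vs u∈ e f , g)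
      path-trans (v ∷ vs) (there u∈) (inj₂ (e , f)) (inj₁ g) = inj₂ (e , path-trans vs u∈ f g)
      path-trans (v ∷ vs) (there u∈) (inj₂ (e , _)) (inj₂ (_ , h)) = inj₂ (e , h)

      edge⇒path : ∀ vs {x y} → Edge x y → Path vs x y
      edge⇒path []       e = e
      edge⇒path (v ∷ vs) e = inj₁ (edge⇒path vs e)

      cancel : ∀ g x y → (g ∙ x) ⁻¹ ∙ (g ∙ y) ≈ x ⁻¹ ∙ y
      cancel g x y = ≈-trans (∙-congʳ (⁻¹-anti-homo-∙ g x))
        (≈-trans (assoc _ _ _) (∙-congˡ (\\-leftDividesʳ g y)))

      path-shift : ∀ g vs {x y} → Path vs x y → Path elements (g ∙ x) (g ∙ y)
      path-shift g [] (inj₁ e) = edge⇒path elements (inj₁ (∙-congˡ e))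
      path-shift g [] (inj₂ (inj₁ e)) =
        edge⇒path elements (inj₂ (inj₁ (X-resp (≈-sym (cancel g _ _)) e)))
      path-shift g [] (inj₂ (inj₂ e)) =
        edge⇒path elements (inj₂ (inj₂ (X-resp (≈-sym (cancel g _ _)) e)))
      path-shift g (v ∷ vs) (inj₁ e) = path-shift g vs e
      path-shift g (v ∷ vs) (inj₂ (e , f)) =
        path-trans elements (complete (g ∙ v)) (path-shift g vs e) (path-shift g vs f)

      sound : ∀ vs {x y} → Path vs x y → ⟨ X ⟩ (x ⁻¹ ∙ y)
      sound [] {x} (inj₁ e) = resp (≈-trans (≈-sym (inverseˡ x)) (∙-congˡ e)) one
      sound [] (inj₂ (inj₁ e)) = gen e
      sound [] {x} {y} (inj₂ (inj₂ e)) =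
        resp (≈-trans (⁻¹-anti-homo-∙ _ _) (∙-congˡ (⁻¹-involutive y))) (inv (gen e))
      sound (v ∷ vs) (inj₁ e) = sound vs e
      sound (v ∷ vs) {x} {y} (inj₂ (e , f)) =
        resp (≈-trans (assoc _ _ _) (∙-congˡ (\\-leftDividesˡ v y)))
          (mul (sound vs e) (sound vs f))

      full : ∀ {x} → ⟨ X ⟩ x → Path elements ε x
      full (gen {x} Xx) = edge⇒path elements
        (inj₂ (inj₁ (X-resp (≈-sym (≈-trans (∙-congʳ ε⁻¹≈ε) (identityˡ x))) Xx)))
      full one = edge⇒path elements (inj₁ ≈-refl)
      full (mul {x} p q) = path-trans elements (complete x) (full p)
        (path-resp elements (identityʳ x) ≈-refl (path-shift x elements (full q)))
      full (inv {x} p) = path-sym elements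
        (path-resp elements (identityʳ (x ⁻¹)) (inverseˡ x)
          (path-shift (x ⁻¹) elements (full p)))
      full (resp x≈y p) = path-resp elements ≈-refl x≈y (full p)

    ⟨⟩? : Decidable ⟨ X ⟩
    ⟨⟩? x = map′
      (λ p → resp (≈-trans (∙-congʳ ε⁻¹≈ε) (identityˡ x)) (sound elements p))
      full
      (path? elements ε x)

  module _
    {K H : Pred Carrier 0ℓ}
    (K-resp : ∀ {x y} → x ≈ y → K x → K y)
    (H-resp : ∀ {x y} → x ≈ y → H x → H y)
    (K? : Decidable K)
    (H? : Decidable H)
    where

    sameLeftCoset? : B.Decidable (SameLeftCoset H)
    sameLeftCoset? x y = H? (x ⁻¹ ∙ y)

    fixesCoset? : Decidable (FixesCoset K H)
    fixesCoset? x = ∀?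
      (λ k≈l f Kl → H-resp (∙-congʳ (⁻¹-cong (∙-congʳ k≈l))) (f (K-resp (≈-sym k≈l) Kl)))
      (λ k → K? k →-dec sameLeftCoset? (k ∙ x) x)

    -- One representative is kept for each fixed coset.
    fixedPointCount : ℕ
    fixedPointCount = length (deduplicate sameLeftCoset? (filter fixesCoset? elements))

-- Products are composed from right to left, whereas _∘ₚ_ composes from
-- left to right.
symmetricGroup : ℕ → Group 0ℓ 0ℓ
symmetricGroup n = record
  { Carrier = Permutation′ n
  ; _≈_     = Perm._≈_
  ; _∙_     = λ π ρ → ρ ∘ₚ π
  ; ε       = Perm.id
  ; _⁻¹     = flip
  ; isGroup = record
    { isMonoid = record
      { isSemigroup = record
        { isMagma = record
          { isEquivalence = record
            { refl  = λ _ → refl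
            ; sym   = λ p i → ≡.sym (p i)
            ; trans = λ p q i → ≡.trans (p i) (q i)
            }
          ; ∙-cong = λ {_} {π′} p q i → ≡.trans (p _) (≡.cong (π′ ⟨$⟩ʳ_) (q i))
          }
        ; assoc = λ _ _ _ _ → refl
        }
      ; identity = (λ _ _ → refl) , (λ _ _ → refl)
      }
    ; inverse = (λ π _ → Perm.inverseˡ π) , (λ π _ → Perm.inverseʳ π)
    ; ⁻¹-cong = λ {π} {ρ} p i → ≡.trans
        (≡.cong (π ⟨$⟩ˡ_) (≡.trans (≡.sym (Perm.inverseʳ ρ)) (≡.sym (p _))))
        (Perm.inverseˡ π)
    }
  }

permutations : ∀ n → List (Permutation′ n)
permutations zero    = [ Perm.id ]
permutations (suc n) = cartesianProductWith (insert 0F) (allFin (suc n)) (permutations n)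

permutations-complete : ∀ n → IsEnumeration (Group.setoid (symmetricGroup n)) (permutations n)
permutations-complete zero    π = here λ ()
permutations-complete (suc n) π =
  ∈-resp-≈ Sₙ₊₁ {permutations (suc n)}
    {insert 0F (π ⟨$⟩ʳ 0F) (remove 0F π)} {π} (insert-remove 0F π)
    (∈-cartesianProductWith⁺ (setoid (Fin (suc n))) Sₙ Sₙ₊₁
      (λ {i} {j} {π} {ρ} → insert-cong {i} {j} {π} {ρ})
      (ListMemₚ.∈-allFin (π ⟨$⟩ʳ 0F))
      (permutations-complete n (remove 0F π)))
  where
  Sₙ   = Group.setoid (symmetricGroup n)
  Sₙ₊₁ = Group.setoid (symmetricGroup (suc n))

  insert-cong : ∀ {i j} {π ρ : Permutation′ n} → i ≡ j → π Perm.≈ ρ →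
                insert 0F i π Perm.≈ insert 0F j ρ
  insert-cong refl p zero    = refl
  insert-cong {i} refl p (suc k) = ≡.cong (punchIn i) (p k)

_≟ₚ_ : ∀ {n} → B.Decidable (Perm._≈_ {n} {n})
π ≟ₚ ρ = Fin.all? λ i → (π ⟨$⟩ʳ i) Fin.≟ (ρ ⟨$⟩ʳ i)

-- The Coxeter group of type A_m, i.e. the symmetric group on m + 1
-- points.  The simple reflections are indexed by Fin m, and subsets of
-- S are represented by their index sets.
module _ {m : ℕ} where
  private
    W : Group 0ℓ 0ℓ
    W = symmetricGroup (suc m)

  open Group W using (Carrier; _≈_; _∙_; ε)
  open GroupTheory W
  open FiniteGroupTheory W _≟ₚ_ (permutations (suc m)) (permutations-complete (suc m))

  s : Fin m → Carrier
  s i = transpose (inject₁ i) (suc i)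

  simpleReflections : Subset m → Pred Carrier 0ℓ
  simpleReflections J x = ∃ λ i → i ∈ₛ J × x ≈ s i

  Parabolic : Subset m → Pred Carrier 0ℓ
  Parabolic J = ⟨ simpleReflections J ⟩

  parabolic? : ∀ J → Decidable (Parabolic J)
  parabolic? J = Membership.⟨⟩?
    (λ x≈y (i , i∈J , x≈s) → i , i∈J , λ k → ≡.trans (≡.sym (x≈y k)) (x≈s k))
    (λ x → Fin.any? λ i → (i ∈ₛ? J) ×-dec (x ≟ₚ s i))

  IsCoxeterElement : Subset m → Pred Carrier 0ℓ
  IsCoxeterElement J c = ∃ λ is →
      Unique is
    × (∀ i → i ListMem.∈ is ⇔ i ∈ₛ J)
    × c ≈ foldr _∙_ ε (map s is)

  ConjugateSubsets : Rel (Subset m) 0ℓ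
  ConjugateSubsets J K = ConjugateSets (simpleReflections J) (simpleReflections K)

  record IsRepresentatives (E : List (Subset m)) : Set where
    field
      exhaustive : ∀ J → Any (ConjugateSubsets J) E
      distinct   : AllPairs (λ J K → ¬ ConjugateSubsets J K) E

  -- The number of fixed points of W_K on W / W_J, the entry of the
  -- parabolic table of marks in row J and column K.
  β : Subset m → Subset m → ℕ
  β J K = fixedPointCount {K = Parabolic K} {H = Parabolic J}
    resp resp (parabolic? K) (parabolic? J)

  module _ (p : ℕ) where

    EqualMod : Rel ℕ 0ℓ
    EqualMod a b = p ∣ ∣ a - b ∣

    equalMod? : B.Decidable EqualMod
    equalMod? a b = p ∣? ∣ a - b ∣

    F : List (Subset m) → List (Subset m)
    F E = filter nonZeroRow? E
      where
      nonZeroRow? : Decidable (λ J → Any (λ K → ¬ EqualMod (β J K) 0) E)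
      nonZeroRow? J = any? (λ K → ¬? (equalMod? (β J K) 0)) E

    EqualColumns : List (Subset m) → Rel (Subset m) 0ℓ
    EqualColumns E K L = All (λ J → EqualMod (β J K) (β J L)) E

    equalColumns? : ∀ E → B.Decidable (EqualColumns E)
    equalColumns? E K L = all? (λ J → equalMod? (β J K) (β J L)) E

    d : List (Subset m) → Subset m → Subset m → ℕ
    d E K L = if does (equalColumns? E K L) then 1 else 0

{-# OPTIONS --safe #-}

-- A coset g W_J is the colouring of the points by J-blocks transported along g, and it is fixed
-- by W_K iff its colouring is invariant under c_K, since the cycles of c_K are the K-blocks.
-- If x′ is the p-regular part of x, then x acts on the colourings fixed by x′ with p-power
-- order, so x and x′ have congruent numbers of fixed points: conjugate p-regular parts give
-- equal columns.
-- Conversely, for the maximal parabolic subgroups J the column of K lists the coefficients of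
-- ∏ (1 + t^a) over the block sizes a of K.  Modulo p, p equal factors 1 + t^a may be replaced by
-- 1 + t^(p a), and a product in which every factor occurs fewer than p times determines its
-- factors.  Hence equal columns give, for each q prime to p, the same number of points in blocks
-- whose size has p′-part q, and these numbers determine the conjugacy class of the p-regular part.

module Submission where

open import Defs
open import Level using (0ℓ)
open import Algebra.Bundles using (Group)
open import Data.Bool.Base as Bool using (Bool; true; false; if_then_else_)
import Data.Bool.Properties as Bool
open import Data.Empty using (⊥; ⊥-elim)
open import Data.Fin.Base using (Fin; zero; suc; toℕ; inject₁; fromℕ<)
open import Data.Fin.Permutation as Perm using (Permutation′; permutation; _⟨$⟩ʳ_; _⟨$⟩ˡ_)
import Data.Fin.Properties as Fin
open import Data.Fin.Subset using (Subset) renaming (_∈_ to _∈ₛ_)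
open import Data.List.Base as List using (List; []; _∷_; [_]; _++_; length; map; filter; foldr; deduplicate; replicate; upTo;
  allFin)
import Data.List.Membership.DecPropositional as DecMembership
open import Data.List.Membership.Propositional using (_∈_; _∉_; find)
open import Data.List.Membership.Propositional.Properties
open import Data.List.Membership.Propositional.Properties.WithK using (unique∧set⇒bag)
open import Data.List.Properties
  using (filter-accept; filter-reject; filter-none; filter-all; filter-++; length-++; length-map; length-replicate;
    length-upTo; length-tabulate; length-filter; map-∘; map-++; map-cong; map-upTo; map-tabulate)
open import Data.List.Relation.Binary.BagAndSetEquality using (∼bag⇒↭)
open import Data.List.Relation.Binary.Permutation.Propositional
  using (_↭_; prep; ↭-refl; ↭-sym; ↭-trans; ↭-reflexive; ↭⇒↭ₛ) renaming (refl to ↭-done; swap to ↭-exch; trans to ↭-then)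
open import Data.List.Relation.Binary.Permutation.Propositional.Properties
  using (All-resp-↭; ∈-resp-↭; filter-↭; ↭-length; map⁺; ++⁺) renaming (shift to ↭-shift)
open import Data.List.Relation.Binary.Permutation.Setoid.Properties using (Unique-resp-↭)
open import Data.List.Relation.Unary.All as All using (All; []; _∷_)
import Data.List.Relation.Unary.All.Properties as All
open import Data.List.Relation.Unary.AllPairs as AllPairs using (AllPairs; []; _∷_)
import Data.List.Relation.Unary.AllPairs.Properties as AllPairs
open import Data.List.Relation.Unary.Any as Any using (any?; here; there)
import Data.List.Relation.Unary.Any.Properties as Any
open import Data.List.Relation.Unary.Sorted.TotalOrder.Properties using (Sorted⇒AllPairs)
import Data.List.Relation.Unary.Unique.DecPropositional.Properties as UniqueDec
open import Data.List.Relation.Unary.Unique.Propositional using (Unique)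
import Data.List.Relation.Unary.Unique.Propositional.Properties as Unique
import Data.List.Sort
open import Data.Nat renaming (_^_ to _^ⁿ_)
open import Data.Nat.Combinatorics using (k>n⇒nCk≡0; nC1≡n; nCn≡1; nCk+nC[k+1]≡[n+1]C[k+1]) renaming (_C_ to _choose_)
open import Data.Nat.Coprimality using (Coprime; coprime-Bézout; coprime-divisor)
open import Data.Nat.DivMod using (m≡m%n+[m/n]*n; m%n<n)
open import Data.Nat.Divisibility
open import Data.Nat.GCD using (gcd; gcd[m,n]∣m; gcd[m,n]∣n; gcd-greatest; gcd[m,n]≡0⇒m≡0; c*gcd[m,n]≡gcd[cm,cn]; module Bézout)
open import Data.Nat.GeneralisedArithmetic using (fold; fold-+)
open import Data.Nat.ListAction using (sum)
open import Data.Nat.ListAction.Properties using (sum-++; sum-↭)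
open import Data.Nat.Primality
open import Data.Nat.Properties
open import Data.Nat.Tactic.RingSolver using (solve-∀)
open import Data.Product using (∃; ∃₂; _×_; _,_; proj₁; proj₂)
open import Data.Sum using (_⊎_; inj₁; inj₂; [_,_]′)
open import Data.Unit.Base using (tt)
open import Data.Vec.Base as Vec using (Vec; []; _∷_; lookup; tabulate; here; there)
open import Data.Vec.Properties using (tabulate-cong; lookup∘tabulate; tabulate∘lookup; ≡-dec)
open import Function.Base
open import Function.Bundles using (_⇔_; mk⇔; Equivalence)
open import Function.Definitions using (Injective)
open import Relation.Binary.Core using (Rel)
open import Relation.Binary.Definitions as Binary using (DecidableEquality; tri<; tri≈; tri>)
open import Relation.Binary.PropositionalEquality hiding ([_]; resp)
open import Relation.Nullary hiding (T?)
open import Relation.Nullary.Decidable using (dec-yes; dec-no; dec-true; dec-false)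
open import Relation.Unary using (Pred; Decidable)

open Equivalence using (to; from)

-- Conjugacy is never decided through a normal form of cycle types. `intertwiner` builds the
-- conjugating permutation from labels that are constant on orbits, determine the orbit length and
-- occur equally often on both sides. To make it applicable, both regular parts are written as
-- powers with one common exponent e, with e congruent to 0 modulo the p-part of (m + 1)! and to 1
-- modulo its p′-part; a cycle then breaks into cycles whose length is the p′-part of the old
-- length, and this length is the label. The label counts can be recovered from the columns because
-- replacing p parts a by one part p a keeps both the p′-part of the size and the number of points
-- covered; the number of blocks is not kept. The letters of a Coxeter element come in an arbitrary
-- order, so its cycles are not computed but detected by invariant functions: f is invariant under
-- c_K iff f is constant on the K-blocks. For the indicator of a cycle this says that the cycle
-- fills its block. E contains only some conjugate of each maximal subset, so the two-colouring that
-- belongs to it has to be transported along the conjugation.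

private
  variable
    A B C D : Set
    m n : ℕ

-- Congruences and generating functions modulo p

module GeneratingFunctions where

  private
    variable
      a b c k : ℕ
      as bs : List ℕ

  module _ (p : ℕ) where

    infix 4 _~_
    -- Multiples of p are allowed on both sides, which makes the relation visibly symmetric and
    -- avoids truncated subtraction.
    _~_ : ℕ → ℕ → Set
    a ~ b = ∃₂ λ s t → a + s * p ≡ b + t * p

  module Congruence {p : ℕ} where

    private
      _≋_ = _~_ p
      infix 4 _≋_

    ≡⇒~ : a ≡ b → a ≋ b
    ≡⇒~ refl = 0 , 0 , refl

    ~-sym : a ≋ b → b ≋ a
    ~-sym (s , t , e) = t , s , sym e

    ~-trans : a ≋ b → b ≋ c → a ≋ c
    ~-trans {a} {b} {c} (s , t , e) (s′ , t′ , e′) = s + s′ , t + t′ , (begin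
      a + (s + s′) * p       ≡⟨ split a s s′ p ⟩
      (a + s * p) + s′ * p   ≡⟨ cong (_+ s′ * p) e ⟩
      (b + t * p) + s′ * p   ≡⟨ swap₂ b (t * p) (s′ * p) ⟩
      (b + s′ * p) + t * p   ≡⟨ cong (_+ t * p) e′ ⟩
      (c + t′ * p) + t * p   ≡⟨ swap₂ c (t′ * p) (t * p) ⟩
      (c + t * p) + t′ * p   ≡⟨ split c t t′ p ⟨
      c + (t + t′) * p       ∎)
      where
      open ≡-Reasoning
      split : ∀ a s s′ p → a + (s + s′) * p ≡ (a + s * p) + s′ * p
      split = solve-∀
      swap₂ : ∀ x y z → (x + y) + z ≡ (x + z) + y
      swap₂ = solve-∀

    ~-+ : ∀ {d} → a ≋ b → c ≋ d → a + c ≋ b + d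
    ~-+ {a} {b} {c} {d} (s , t , e) (s′ , t′ , e′) = s + s′ , t + t′ ,
      trans (regroup a c s s′ p) (trans (cong₂ _+_ e e′) (sym (regroup b d t t′ p)))
      where
      regroup : ∀ a c s s′ p → (a + c) + (s + s′) * p ≡ (a + s * p) + (c + s′ * p)
      regroup = solve-∀

    ~-+-cancelʳ : ∀ {d} → a + c ≋ b + d → c ≋ d → a ≋ b
    ~-+-cancelʳ {a} {c} {b} {d} (s , t , e) (s′ , t′ , e′) =
      s + t′ , t + s′ , +-cancelʳ-≡ (c + d) _ _ (begin
        (a + (s + t′) * p) + (c + d)        ≡⟨ left a c d s t′ p ⟩
        ((a + c) + s * p) + (d + t′ * p)    ≡⟨ cong₂ _+_ e (sym e′) ⟩
        ((b + d) + t * p) + (c + s′ * p)    ≡⟨ right b c d t s′ p ⟩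
        (b + (t + s′) * p) + (c + d)        ∎)
      where
      open ≡-Reasoning
      left : ∀ a c d s t p → (a + (s + t) * p) + (c + d) ≡ ((a + c) + s * p) + (d + t * p)
      left = solve-∀
      right : ∀ b c d t s p → ((b + d) + t * p) + (c + s * p) ≡ (b + (t + s) * p) + (c + d)
      right = solve-∀

    ∣⇒~0 : p ∣ a → a ≋ 0
    ∣⇒~0 (divides q e) = 0 , q , trans (+-identityʳ _) e

    ~0⇒∣ : a ≋ 0 → p ∣ a
    ~0⇒∣ {a} (s , t , e) = ∣m+n∣n⇒∣m (divides t e) (divides s refl)
      where
      ∣m+n∣n⇒∣m : ∀ {m n} → p ∣ m + n → p ∣ n → p ∣ m
      ∣m+n∣n⇒∣m {m} {n} d = ∣m+n∣m⇒∣n (subst (p ∣_) (+-comm m n) d)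

    ~⇒∣∣-∣ : a ≋ b → p ∣ ∣ a - b ∣
    ~⇒∣∣-∣ {a} {b} a≋b with ≤-total a b
    ... | inj₁ a≤b with c , refl ← m≤n⇒∃[o]m+o≡n a≤b =
      subst (p ∣_) (sym (∣m-m+n∣≡n a c))
        (~0⇒∣ (~-+-cancelʳ {d = a} (~-trans (≡⇒~ (+-comm c a)) (~-sym a≋b)) (≡⇒~ refl)))
    ... | inj₂ b≤a with c , refl ← m≤n⇒∃[o]m+o≡n b≤a =
      subst (p ∣_) (sym (trans (∣-∣-comm (b + c) b) (∣m-m+n∣≡n b c)))
        (~0⇒∣ (~-+-cancelʳ {d = b} (~-trans (≡⇒~ (+-comm c b)) a≋b) (≡⇒~ refl)))

    ∣∣-∣⇒~ : p ∣ ∣ a - b ∣ → a ≋ b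
    ∣∣-∣⇒~ {a} {b} d with ≤-total a b
    ... | inj₁ a≤b with c , refl ← m≤n⇒∃[o]m+o≡n a≤b | divides q e ← d =
      q , 0 , trans (cong (a +_) (trans (sym e) (∣m-m+n∣≡n a c))) (sym (+-identityʳ _))
    ... | inj₂ b≤a with c , refl ← m≤n⇒∃[o]m+o≡n b≤a | divides q e ← d =
      0 , q , trans (+-identityʳ _)
        (cong (b +_) (trans (sym (trans (∣-∣-comm (b + c) b) (∣m-m+n∣≡n b c))) e))

  open Congruence

  -- Multiplication of a power series by t^a.
  shift : ℕ → (ℕ → ℕ) → ℕ → ℕ
  shift zero    f b       = f b
  shift (suc a) f zero    = 0
  shift (suc a) f (suc b) = shift a f b

  -- The coefficient of t^b in ∏ (1 + t^a), a ranging over the list.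
  subsums : List ℕ → ℕ → ℕ
  subsums []       zero    = 1
  subsums []       (suc _) = 0
  subsums (a ∷ as) b       = subsums as b + shift a (subsums as) b

  sumTo : ℕ → (ℕ → ℕ) → ℕ
  sumTo zero    g = 0
  sumTo (suc k) g = g 0 + sumTo k (g ∘ suc)

  shift-cong : ∀ a {f g : ℕ → ℕ} → (∀ b → f b ≡ g b) → ∀ b → shift a f b ≡ shift a g b
  shift-cong zero    e b       = e b
  shift-cong (suc a) e zero    = refl
  shift-cong (suc a) e (suc b) = shift-cong a e b

  shift-+ : ∀ a {f g} b → shift a (λ b → f b + g b) b ≡ shift a f b + shift a g b
  shift-+ zero    b       = refl
  shift-+ (suc a) zero    = refl
  shift-+ (suc a) (suc b) = shift-+ a b

  shift-shift : ∀ a c f b → shift a (shift c f) b ≡ shift (a + c) f b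
  shift-shift zero    c f b       = refl
  shift-shift (suc a) c f zero    = refl
  shift-shift (suc a) c f (suc b) = shift-shift a c f b

  shift-< : ∀ {f} → b < a → shift a f b ≡ 0
  shift-< {zero}  (s≤s _)           = refl
  shift-< {suc b} (s≤s b<a) = shift-< b<a

  shift-+ʳ : ∀ a {f} b → shift a f (a + b) ≡ f b
  shift-+ʳ zero    b = refl
  shift-+ʳ (suc a) b = shift-+ʳ a b

  sumTo-cong : ∀ k {g h : ℕ → ℕ} → (∀ j → g j ≡ h j) → sumTo k g ≡ sumTo k h
  sumTo-cong zero    e = refl
  sumTo-cong (suc k) e = cong₂ _+_ (e 0) (sumTo-cong k (e ∘ suc))

  sumTo-+ : ∀ k g h → sumTo k (λ j → g j + h j) ≡ sumTo k g + sumTo k h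
  sumTo-+ zero    g h = refl
  sumTo-+ (suc k) g h = trans (cong (g 0 + h 0 +_) (sumTo-+ k (g ∘ suc) (h ∘ suc))) (lemma (g 0) (h 0) _ _)
    where
    lemma : ∀ a b c d → a + b + (c + d) ≡ a + c + (b + d)
    lemma = solve-∀

  sumTo-last : ∀ k g → sumTo (suc k) g ≡ sumTo k g + g k
  sumTo-last zero    g = +-comm (g 0) 0
  sumTo-last (suc k) g = trans (cong (g 0 +_) (sumTo-last k (g ∘ suc))) (sym (+-assoc (g 0) _ _))

  sumTo-~0 : ∀ {p} k {g} → (∀ j → j < k → _~_ p (g j) 0) → _~_ p (sumTo k g) 0
  sumTo-~0 zero    z = ≡⇒~ refl
  sumTo-~0 (suc k) z = ~-+ (z 0 z<s) (sumTo-~0 k (λ j j<k → z (suc j) (s<s j<k)))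

  shift-sumTo : ∀ a k (c : ℕ → ℕ) (h : ℕ → ℕ → ℕ) b →
    shift a (λ b → sumTo k (λ j → c j * h j b)) b ≡ sumTo k (λ j → c j * shift a (h j) b)
  shift-sumTo zero    k c h b       = refl
  shift-sumTo (suc a) k c h zero    = sym (zeros k (λ j → *-zeroʳ (c j)))
    where
    zeros : ∀ k {g} → (∀ j → g j ≡ 0) → sumTo k g ≡ 0
    zeros zero    z = refl
    zeros (suc k) z = cong₂ _+_ (z 0) (zeros k (z ∘ suc))
  shift-sumTo (suc a) k c h (suc b) = shift-sumTo a k c h b

  -- The expansion of (1 + t^a)^k times the remaining product. The inductive step is Pascal's rule,
  -- applied after the first sum has been padded by the vanishing term `k choose suc k` (`widen`).
  binomial : ∀ k a as b →
    subsums (replicate k a ++ as) b ≡ sumTo (suc k) (λ j → (k choose j) * shift (j * a) (subsums as) b)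
  binomial zero    a as b = sym (trans (+-identityʳ _) (+-identityʳ _))
  binomial (suc k) a as b = begin
    subsums (replicate k a ++ as) b + shift a (subsums (replicate k a ++ as)) b
      ≡⟨ cong₂ _+_ (binomial k a as b) (shift-cong a (binomial k a as) b) ⟩
    sumTo (suc k) (g k) + shift a (λ b → sumTo (suc k) (λ j → (k choose j) * shift (j * a) (subsums as) b)) b
      ≡⟨ cong₂ _+_ widen (shift-sumTo a (suc k) (k choose_) (λ j → shift (j * a) (subsums as)) b) ⟩
    sumTo (suc (suc k)) (g k) + sumTo (suc k) (λ j → (k choose j) * shift a (shift (j * a) (subsums as)) b)
      ≡⟨ cong (sumTo (suc (suc k)) (g k) +_)
          (sumTo-cong (suc k) λ j → cong ((k choose j) *_) (shift-shift a (j * a) (subsums as) b)) ⟩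
    g k 0 + sumTo (suc k) (g k ∘ suc) + sumTo (suc k) (λ j → (k choose j) * G (suc j))
      ≡⟨ +-assoc (g k 0) _ _ ⟩
    g k 0 + (sumTo (suc k) (g k ∘ suc) + sumTo (suc k) (λ j → (k choose j) * G (suc j)))
      ≡⟨ cong (g k 0 +_) (sumTo-+ (suc k) (g k ∘ suc) (λ j → (k choose j) * G (suc j))) ⟨
    g k 0 + sumTo (suc k) (λ j → (k choose suc j) * G (suc j) + (k choose j) * G (suc j))
      ≡⟨ cong (g k 0 +_) (sumTo-cong (suc k) pascal) ⟩
    sumTo (suc (suc k)) (g (suc k)) ∎
    where
    open ≡-Reasoning
    G : ℕ → ℕ
    G j = shift (j * a) (subsums as) b
    g : ℕ → ℕ → ℕ
    g k j = (k choose j) * G j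
    widen : sumTo (suc k) (g k) ≡ sumTo (suc (suc k)) (g k)
    widen = sym (trans (sumTo-last (suc k) (g k))
      (trans (cong (λ x → sumTo (suc k) (g k) + x * G (suc k)) (k>n⇒nCk≡0 (n<1+n k))) (+-identityʳ _)))
    pascal : ∀ j → (k choose suc j) * G (suc j) + (k choose j) * G (suc j) ≡ g (suc k) (suc j)
    pascal j = trans (sym (*-distribʳ-+ (G (suc j)) (k choose suc j) (k choose j)))
      (cong (_* G (suc j)) (trans (+-comm (k choose suc j) (k choose j)) (nCk+nC[k+1]≡[n+1]C[k+1] k j)))

  -- The absorption identity; with n + 1 prime it exhibits the prime as a factor of the left-hand
  -- side.
  [1+k]*[1+n]C[1+k]≡[1+n]*nCk : ∀ n k → suc k * (suc n choose suc k) ≡ suc n * (n choose k)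
  [1+k]*[1+n]C[1+k]≡[1+n]*nCk n zero =
    trans (+-identityʳ _) (trans (nC1≡n (suc n)) (sym (*-identityʳ (suc n))))
  [1+k]*[1+n]C[1+k]≡[1+n]*nCk zero (suc k) = begin
    suc (suc k) * (1 choose suc (suc k))  ≡⟨ cong (suc (suc k) *_) (k>n⇒nCk≡0 {1} {suc (suc k)} (s<s z<s)) ⟩
    suc (suc k) * 0                  ≡⟨ *-zeroʳ (suc (suc k)) ⟩
    0                                ≡⟨ cong (1 *_) (k>n⇒nCk≡0 {0} {suc k} z<s) ⟨
    1 * (0 choose suc k)                  ∎
    where open ≡-Reasoning
  [1+k]*[1+n]C[1+k]≡[1+n]*nCk (suc n) (suc k) = begin
    suc (suc k) * (suc (suc n) choose suc (suc k))
      ≡⟨ cong (suc (suc k) *_) (nCk+nC[k+1]≡[n+1]C[k+1] (suc n) (suc k)) ⟨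
    suc (suc k) * (x + (suc n choose suc (suc k)))
      ≡⟨ *-distribˡ-+ (suc (suc k)) x _ ⟩
    x + suc k * x + suc (suc k) * (suc n choose suc (suc k))
      ≡⟨ cong₂ (λ y z → x + y + z) ([1+k]*[1+n]C[1+k]≡[1+n]*nCk n k) ([1+k]*[1+n]C[1+k]≡[1+n]*nCk n (suc k)) ⟩
    x + suc n * (n choose k) + suc n * (n choose suc k)
      ≡⟨ trans (+-assoc x _ _) (cong (x +_) (sym (*-distribˡ-+ (suc n) (n choose k) _))) ⟩
    x + suc n * ((n choose k) + (n choose suc k))
      ≡⟨ cong (λ y → x + suc n * y) (nCk+nC[k+1]≡[n+1]C[k+1] n k) ⟩
    suc (suc n) * x ∎
    where
    open ≡-Reasoning
    x = suc n choose suc k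

  prime∣nCk : ∀ {r j} → Prime (suc r) → j < r → suc r ∣ (suc r choose suc j)
  prime∣nCk {r} {j} pr j<r
    with euclidsLemma (suc j) (suc r choose suc j) pr
           (subst (suc r ∣_) (sym ([1+k]*[1+n]C[1+k]≡[1+n]*nCk r j)) (m∣m*n (r choose j)))
  ... | inj₁ d = ⊥-elim (>⇒∤ (s<s j<r) d)
  ... | inj₂ d = d

  -- (1 + t^a)^p ≡ 1 + t^(p a) modulo p.
  frobenius : ∀ {p} → Prime p → ∀ a as b →
    _~_ p (subsums (replicate p a ++ as) b) (subsums (p * a ∷ as) b)
  frobenius {zero} pr = ⊥-elim (¬prime[0] pr)
  frobenius {suc r} pr a as b =
    ~-trans (≡⇒~ (binomial (suc r) a as b))
      (~-+ (≡⇒~ first) (~-trans (≡⇒~ (sumTo-last r (g ∘ suc))) (~-+ middle (≡⇒~ last))))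
    where
    g : ℕ → ℕ
    g j = (suc r choose j) * shift (j * a) (subsums as) b
    first : g 0 ≡ subsums as b
    first = +-identityʳ _
    last : g (suc r) ≡ shift (suc r * a) (subsums as) b
    last = trans (cong (_* shift (suc r * a) (subsums as) b) (nCn≡1 (suc r))) (+-identityʳ _)
    middle : _~_ (suc r) (sumTo r (g ∘ suc)) 0
    middle = sumTo-~0 r λ j j<r → ∣⇒~0 (∣m⇒∣m*n _ (prime∣nCk pr j<r))

  subsums-↭ : as ↭ bs → ∀ b → subsums as b ≡ subsums bs b
  subsums-↭ ↭-done b = refl
  subsums-↭ (prep a e) b = cong₂ _+_ (subsums-↭ e b) (shift-cong a (subsums-↭ e) b)
  subsums-↭ (↭-exch {as} {bs} a c e) b = begin
    (f as + shift c Φ b) + shift a (λ b → Φ b + shift c Φ b) b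
      ≡⟨ cong (f as + shift c Φ b +_) (shift-+ a b) ⟩
    (f as + shift c Φ b) + (shift a Φ b + shift a (shift c Φ) b)
      ≡⟨ cong (λ z → (f as + shift c Φ b) + (shift a Φ b + z))
          (trans (shift-shift a c Φ b) (trans (cong (λ z → shift z Φ b) (+-comm a c)) (sym (shift-shift c a Φ b)))) ⟩
    (f as + shift c Φ b) + (shift a Φ b + shift c (shift a Φ) b)
      ≡⟨ lemma (f as) _ _ _ ⟩
    (f as + shift a Φ b) + (shift c Φ b + shift c (shift a Φ) b)
      ≡⟨ cong (f as + shift a Φ b +_) (shift-+ c b) ⟨
    subsums (c ∷ a ∷ as) b
      ≡⟨ cong₂ _+_ (cong₂ _+_ (subsums-↭ e b) (shift-cong a (subsums-↭ e) b))
           (shift-cong c (λ b → cong₂ _+_ (subsums-↭ e b) (shift-cong a (subsums-↭ e) b)) b) ⟩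
    subsums (c ∷ a ∷ bs) b ∎
    where
    open ≡-Reasoning
    Φ = subsums as
    f : List ℕ → ℕ
    f as = subsums as b
    lemma : ∀ x y z w → (x + y) + (z + w) ≡ (x + z) + (y + w)
    lemma = solve-∀
  subsums-↭ (↭-then e e′) b = trans (subsums-↭ e b) (subsums-↭ e′ b)

  subsums-0 : All (0 <_) as → subsums as 0 ≡ 1
  subsums-0 [] = refl
  subsums-0 {as = suc a ∷ as} (_ ∷ ps) = trans (+-identityʳ _) (subsums-0 ps)

  subsums-> : ∀ as → sum as < b → subsums as b ≡ 0
  subsums-> {suc b} []       _ = refl
  subsums-> {b} (a ∷ as) lt with m≤n⇒∃[o]m+o≡n {a} {b} (≤-trans (m≤m+n a (sum as)) (<⇒≤ lt))
  ... | c , refl = cong₂ _+_ (subsums-> as (≤-<-trans (m≤n+m (sum as) a) lt))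
    (trans (shift-+ʳ a c) (subsums-> as (+-cancelˡ-< a (sum as) c lt)))

  subsums-sum : All (0 <_) as → subsums as (sum as) ≡ 1
  subsums-sum [] = refl
  subsums-sum {as = a ∷ as} (a>0 ∷ ps) =
    cong₂ _+_ (subsums-> as (m<n+m (sum as) a>0)) (trans (shift-+ʳ a (sum as)) (subsums-sum ps))

  count : ℕ → List ℕ → ℕ
  count a as = length (filter (a ≟_) as)

  count-∷ : ∀ a as → count a (a ∷ as) ≡ suc (count a as)
  count-∷ a as = cong length (filter-accept (a ≟_) refl)

  count-≤-∷ : ∀ a c as → count a as ≤ count a (c ∷ as)
  count-≤-∷ a c as with a ≟ c
  ... | yes refl = ≤-trans (n≤1+n _) (≤-reflexive (sym (count-∷ a as)))
  ... | no a≢c   = ≤-reflexive (sym (cong length (filter-reject (a ≟_) a≢c)))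

  -- When no part is smaller than a, a choice of parts with sum a is a single part equal to a. So
  -- the lowest coefficient after the constant term reveals the multiplicity of the least part.
  subsums-least : 0 < a → All (a ≤_) as → subsums as a ≡ count a as
  subsums-least {suc a} a>0 [] = refl
  subsums-least {a} {c ∷ as} a>0 (a≤c ∷ a≤) with a ≟ c
  ... | yes refl = begin
    subsums as a + shift a (subsums as) a
      ≡⟨ cong₂ (λ x y → x + shift a (subsums as) y) (subsums-least a>0 a≤) (sym (+-identityʳ a)) ⟩
    count a as + shift a (subsums as) (a + 0)
      ≡⟨ cong (count a as +_) (trans (shift-+ʳ a 0) (subsums-0 (All.map (<-≤-trans a>0) a≤))) ⟩
    count a as + 1
      ≡⟨ trans (+-comm _ 1) (sym (count-∷ a as)) ⟩
    count a (a ∷ as) ∎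
    where open ≡-Reasoning
  ... | no a≢c = trans (cong₂ _+_ (subsums-least a>0 a≤) (shift-< (≤∧≢⇒< a≤c a≢c)))
    (trans (+-identityʳ _) (sym (cong length (filter-reject (a ≟_) a≢c))))

  count-none : All (a <_) as → count a as ≡ 0
  count-none {a} a< = cong length (filter-none (a ≟_) (All.map <⇒≢ a<))

  replicate-count : ∀ k a as → k ≤ count a as → ∃ λ bs → as ↭ replicate k a ++ bs
  replicate-count zero    a as       _ = as , ↭-done
  replicate-count (suc k) a (c ∷ as) le with a ≟ c
  ... | yes refl with bs , e ← replicate-count k a as (s≤s⁻¹ (≤-trans le (≤-reflexive (count-∷ a as)))) =
    bs , prep a e
  ... | no a≢c with bs , e ← replicate-count (suc k) a as
                     (≤-trans le (≤-reflexive (cong length (filter-reject (a ≟_) a≢c)))) =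
    c ∷ bs , ↭-then (prep c e) (↭-sym (↭-shift c (replicate (suc k) a) bs))

  -- A block of size a counts once for each of its a points. This factor makes p parts `a` weigh as
  -- much as one part `p * a` whenever φ takes the same value on both.
  weight : (ℕ → ℕ) → List ℕ → ℕ
  weight φ as = sum (map (λ a → a * φ a) as)

  weight-↭ : ∀ φ → as ↭ bs → weight φ as ≡ weight φ bs
  weight-↭ φ e = sum-↭ (map⁺ _ e)

  weight-replicate : ∀ φ k a as → weight φ (replicate k a ++ as) ≡ k * (a * φ a) + weight φ as
  weight-replicate φ zero    a as = refl
  weight-replicate φ (suc k) a as =
    trans (cong (a * φ a +_) (weight-replicate φ k a as)) (sym (+-assoc (a * φ a) _ _))

  Reduced : ℕ → List ℕ → Set
  Reduced p as = ∀ a → count a as < p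

  -- Reduction forgets the partition itself; `weights` records what it still remembers.
  record Reduction (p : ℕ) (as : List ℕ) : Set where
    field
      parts    : List ℕ
      positive : All (0 <_) parts
      reduced  : Reduced p parts
      sums     : ∀ b → _~_ p (subsums as b) (subsums parts b)
      weights  : ∀ φ → (∀ a → φ (p * a) ≡ φ a) → weight φ as ≡ weight φ parts

  -- While some part `a` occurs p times, p copies are merged into `p * a` by `frobenius`. Each merge
  -- shortens the list because p > 1, so the length bounds the recursion.
  reduce : ∀ {p} → Prime p → ∀ as → All (0 <_) as → Reduction p as
  reduce {p} pr as = go (length as) as ≤-refl
    where
    1<p : 1 < p
    1<p = nonTrivial⇒n>1 p {{prime⇒nonTrivial pr}}

    reduced? : ∀ as → Reduced p as ⊎ ∃ λ a → p ≤ count a as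
    reduced? as with any? (λ a → p ≤? count a as) as
    ... | yes big  = inj₂ (Any.satisfied big)
    ... | no ¬big = inj₁ red
      where
      red : Reduced p as
      red a with p ≤? count a as
      ... | no p≰ = ≰⇒> p≰
      -- `any?` has tested only members of the list; since p is positive, p occurrences of `a` make
      -- it a member.
      ... | yes p≤ with m≤n⇒∃[o]m+o≡n (<⇒≤ 1<p)
      ... | r , refl with bs , e ← replicate-count p a as p≤ =
        ⊥-elim (¬big (Any.map (λ { refl → p≤ }) (∈-resp-↭ (↭-sym e) (Any.here refl))))

    go : ∀ l as → length as ≤ l → All (0 <_) as → Reduction p as

    merge : ∀ l {a as bs} → length as ≤ l → as ↭ replicate p a ++ bs → All (0 <_) as → Reduction p as
    merge l {a} {as} {bs} le e pos = step l le
      where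
      len : suc (length (p * a ∷ bs)) ≤ length as
      len = ≤-trans (+-monoˡ-≤ (length bs) 1<p)
        (≤-reflexive (trans (cong (_+ length bs) (sym (length-replicate p)))
          (trans (sym (length-++ (replicate p a))) (sym (↭-length e)))))
      pos′ : All (0 <_) (replicate p a ++ bs)
      pos′ = All-resp-↭ e pos
      a>0 : ∀ {k} → 0 < k → All (0 <_) (replicate k a ++ bs) → 0 < a
      a>0 (s≤s _) (x ∷ _) = x
      pos″ : All (0 <_) (p * a ∷ bs)
      pos″ = *-mono-< {0} {p} {0} {a} (<-trans z<s 1<p) (a>0 (<-trans z<s 1<p) pos′)
        ∷ All.++⁻ʳ (replicate p a) pos′
      step : ∀ l → length as ≤ l → Reduction p as
      step zero    le with () ← ≤-trans len le
      step (suc l) le = record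
        { parts    = parts
        ; positive = positive
        ; reduced  = reduced
        ; sums     = λ b → ~-trans (≡⇒~ (subsums-↭ e b)) (~-trans (frobenius pr a bs b) (sums b))
        ; weights  = λ φ inv → begin
            weight φ as                        ≡⟨ weight-↭ φ e ⟩
            weight φ (replicate p a ++ bs)     ≡⟨ weight-replicate φ p a bs ⟩
            p * (a * φ a) + weight φ bs        ≡⟨ cong (_+ weight φ bs) (*-assoc p a (φ a)) ⟨
            p * a * φ a + weight φ bs          ≡⟨ cong (λ x → p * a * x + weight φ bs) (inv a) ⟨
            weight φ (p * a ∷ bs)              ≡⟨ weights φ inv ⟩
            weight φ parts                     ∎
        }
        where
        open Reduction (go l (p * a ∷ bs) (s≤s⁻¹ (≤-trans len le)) pos″)
        open ≡-Reasoning

    go l as le pos with reduced? as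
    ... | inj₁ red = record
      { parts = as ; positive = pos ; reduced = red ; sums = λ _ → ≡⇒~ refl ; weights = λ _ _ → refl }
    ... | inj₂ (a , p≤) with bs , e ← replicate-count p a as p≤ = merge l le e pos

  -- Compare the least parts. If they differ, the coefficient at the smaller one is a multiplicity
  -- strictly between 0 and p on one side and 0 on the other (`clash`). If they agree, the common
  -- factor is divided out (`cancel`).
  sorted-unique : ∀ {p} as bs → AllPairs _≤_ as → AllPairs _≤_ bs → All (0 <_) as → All (0 <_) bs →
    Reduced p as → Reduced p bs → (∀ b → _~_ p (subsums as b) (subsums bs b)) → as ≡ bs
  sorted-unique {p} = go
    where
    clash : ∀ {a as bs} → 0 < a → All (a ≤_) as → All (a <_) bs → Reduced p (a ∷ as) →
      ¬ (∀ b → _~_ p (subsums (a ∷ as) b) (subsums bs b))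
    clash {a} {as} {bs} a>0 a≤ a< red sim = >⇒∤ {{>-nonZero pos}} (red a) (~0⇒∣
      (~-trans (≡⇒~ (sym (subsums-least a>0 (≤-refl ∷ a≤))))
        (~-trans (sim a) (≡⇒~ (trans (subsums-least a>0 (All.map <⇒≤ a<)) (count-none a<))))))
      where
      pos : 0 < count a (a ∷ as)
      pos = ≤-trans z<s (≤-reflexive (sym (count-∷ a as)))

    -- Division by 1 + t^a, which has constant term 1: a coefficient of the quotient is determined
    -- by that of the product and by lower coefficients of the quotient, hence the induction on a
    -- bound for b.
    cancel : ∀ a as bs → 0 < a → (∀ b → _~_ p (subsums (a ∷ as) b) (subsums (a ∷ bs) b)) →
      ∀ b → _~_ p (subsums as b) (subsums bs b)
    cancel (suc a) as bs _ sim b = below b b ≤-refl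
      where
      shifted : ∀ {l f g} → (∀ b → b ≤ l → _~_ p (f b) (g b)) → ∀ a b → b ≤ suc l → _~_ p (shift (suc a) f b) (shift (suc a) g b)
      shifted h a       zero    _         = ≡⇒~ refl
      shifted h zero    (suc b) (s≤s b≤l) = h b b≤l
      shifted h (suc a) (suc b) (s≤s b≤l) = shifted h a b (m≤n⇒m≤1+n b≤l)
      below : ∀ l b → b ≤ l → _~_ p (subsums as b) (subsums bs b)
      below zero    .0 z≤n = ~-+-cancelʳ (sim 0) (≡⇒~ refl)
      below (suc l) b  b≤l = ~-+-cancelʳ (sim b) (shifted (below l) a b b≤l)

    go : ∀ as bs → AllPairs _≤_ as → AllPairs _≤_ bs → All (0 <_) as → All (0 <_) bs →
      Reduced p as → Reduced p bs → (∀ b → _~_ p (subsums as b) (subsums bs b)) → as ≡ bs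
    go [] [] _ _ _ _ _ _ _ = refl
    go [] (b ∷ bs) _ (b≤ ∷ _) _ (b>0 ∷ _) _ rb sim = ⊥-elim (clash b>0 b≤ [] rb (~-sym ∘ sim))
    go (a ∷ as) [] (a≤ ∷ _) _ (a>0 ∷ _) _ ra _ sim = ⊥-elim (clash a>0 a≤ [] ra sim)
    go (a ∷ as) (b ∷ bs) (a≤ ∷ sa) (b≤ ∷ sb) (a>0 ∷ pa) (b>0 ∷ pb) ra rb sim with <-cmp a b
    ... | tri< a<b _ _ = ⊥-elim (clash a>0 a≤ (a<b ∷ All.map (<-≤-trans a<b) b≤) ra sim)
    ... | tri> _ _ b<a = ⊥-elim (clash b>0 b≤ (b<a ∷ All.map (<-≤-trans b<a) a≤) rb (~-sym ∘ sim))
    ... | tri≈ _ refl _ = cong (a ∷_) (go as bs sa sb pa pb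
      (λ c → ≤-<-trans (count-≤-∷ c a as) (ra c)) (λ c → ≤-<-trans (count-≤-∷ c a bs) (rb c))
      (cancel a as bs a>0 sim))

  open Data.List.Sort ≤-decTotalOrder using (sort; sort-↭; sort-↗)

  -- Modulo p the series cannot tell p parts `a` from one part `p * a`, so only weights blind to a
  -- factor p can be recovered. These survive reduction, and the reduced lists coincide after
  -- sorting.
  subsums-determine-weight : ∀ {p} → Prime p → ∀ as bs → All (0 <_) as → All (0 <_) bs →
    (∀ b → _~_ p (subsums as b) (subsums bs b)) →
    ∀ φ → (∀ a → φ (p * a) ≡ φ a) → weight φ as ≡ weight φ bs
  subsums-determine-weight {p} pr as bs pa pb sim φ inv = begin
    weight φ as              ≡⟨ A.weights φ inv ⟩
    weight φ A.parts         ≡⟨ weight-↭ φ (sort-↭ A.parts) ⟨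
    weight φ (sort A.parts)  ≡⟨ cong (weight φ) same ⟩
    weight φ (sort B.parts)  ≡⟨ weight-↭ φ (sort-↭ B.parts) ⟩
    weight φ B.parts         ≡⟨ B.weights φ inv ⟨
    weight φ bs              ∎
    where
    open ≡-Reasoning
    module A = Reduction (reduce pr as pa)
    module B = Reduction (reduce pr bs pb)
    red : ∀ {cs} → Reduced p cs → Reduced p (sort cs)
    red {cs} r a = ≤-<-trans (≤-reflexive (↭-length (filter-↭ (a ≟_) (sort-↭ cs)))) (r a)
    same : sort A.parts ≡ sort B.parts
    same = sorted-unique _ _
      (Sorted⇒AllPairs ≤-totalOrder (sort-↗ A.parts)) (Sorted⇒AllPairs ≤-totalOrder (sort-↗ B.parts))
      (All-resp-↭ (↭-sym (sort-↭ A.parts)) A.positive) (All-resp-↭ (↭-sym (sort-↭ B.parts)) B.positive)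
      (red A.reduced) (red B.reduced)
      (λ b → ~-trans (≡⇒~ (subsums-↭ (sort-↭ A.parts) b)) (~-trans (~-sym (A.sums b)) (~-trans (sim b)
        (~-trans (B.sums b) (≡⇒~ (sym (subsums-↭ (sort-↭ B.parts) b)))))))

  -- Maximal parabolic subgroups provide only the coefficients at 1 to n. The constant and the
  -- leading coefficients are 1 in both products, and beyond the common degree n + 1 everything
  -- vanishes.
  subsums-~-extend : ∀ {p} as bs → All (0 <_) as → All (0 <_) bs → sum as ≡ suc n → sum bs ≡ suc n →
    (∀ b → b < n → _~_ p (subsums as (suc b)) (subsums bs (suc b))) →
    ∀ b → _~_ p (subsums as b) (subsums bs b)
  subsums-~-extend as bs pa pb sa sb h zero = ≡⇒~ (trans (subsums-0 pa) (sym (subsums-0 pb)))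
  subsums-~-extend {n} as bs pa pb sa sb h (suc b) with <-cmp b n
  ... | tri< b<n _ _ = h b b<n
  ... | tri≈ _ refl _ = ≡⇒~ (trans (top as pa sa) (sym (top bs pb sb)))
    where
    top : ∀ as → All (0 <_) as → sum as ≡ suc b → subsums as (suc b) ≡ 1
    top as pa sa = subst (λ x → subsums as x ≡ 1) sa (subsums-sum pa)
  ... | tri> _ _ n<b = ≡⇒~ (trans (subsums-> as (subst (_< suc b) (sym sa) (s<s n<b)))
    (sym (subsums-> bs (subst (_< suc b) (sym sb) (s<s n<b)))))

open GeneratingFunctions
open Congruence

-- Orbits of an injective map

unique∧set⇒↭ : {xs ys : List A} → Unique xs → Unique ys → (∀ {x} → x ∈ xs ⇔ x ∈ ys) → xs ↭ ys
unique∧set⇒↭ xs! ys! e = ∼bag⇒↭ (unique∧set⇒bag xs! ys! e)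

module _ {T : ℕ → Set} (T? : Decidable T) (T-+ : ∀ {a b} → T a → T b → T (a + b))
         (T-∸ : ∀ {a b} → T a → T (a + b) → T b) where

  -- `T` behaves like the non-negative half of a subgroup of the integers: the remainder of any
  -- element modulo the least positive one lies in `T` again and is therefore 0. This yields periods
  -- of points, orders of permutations and, in `preserved-regularPart`, the exponents that leave a
  -- function invariant.
  generator : ∀ {n} → 0 < n → T n → ∃ λ k → 0 < k × (∀ j → T j ⇔ k ∣ j)
  generator {suc n} _ Tn = search n 0 (λ { _ () _ }) (subst T (+-comm 1 n) Tn)
    where
    finish : ∀ k → (∀ j → j < k → ¬ T (suc j)) → T (suc k) → ∀ j → T j ⇔ suc k ∣ j
    finish k min Tk j = mk⇔ dvd (λ { (divides-refl q) → mult q })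
      where
      mult : ∀ q → T (q * suc k)
      mult zero    = T-∸ Tk (subst T (sym (+-identityʳ _)) Tk)
      mult (suc q) = T-+ Tk (mult q)
      remainder : ∀ r → r < suc k → T r → r ≡ 0
      remainder zero    _         _  = refl
      remainder (suc r) (s≤s r<k) Tr = ⊥-elim (min r r<k Tr)
      dvd : T j → suc k ∣ j
      dvd Tj = m%n≡0⇒n∣m j (suc k) (remainder (j % suc k) (m%n<n j (suc k))
        (T-∸ (mult (j / suc k)) (subst T (trans (m≡m%n+[m/n]*n j (suc k)) (+-comm (j % suc k) _)) Tj)))
    -- `f` is fuel: the sum `f + suc k` stays equal to the known element of `T`, so the search stops
    -- there at the latest.
    search : ∀ f k → (∀ j → j < k → ¬ T (suc j)) → T (f + suc k) →
      ∃ λ k → 0 < k × (∀ j → T j ⇔ k ∣ j)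
    search f k min Tf with T? (suc k)
    ... | yes Tk = suc k , z<s , finish k min Tk
    search zero    k min Tf | no ¬Tk = ⊥-elim (¬Tk Tf)
    search (suc f) k min Tf | no ¬Tk = search f (suc k) min′ (subst T (sym (+-suc f (suc k))) Tf)
      where
      min′ : ∀ j → j < suc k → ¬ T (suc j)
      min′ j j<1+k with m≤n⇒m<n∨m≡n (s≤s⁻¹ j<1+k)
      ... | inj₁ j<k  = min j j<k
      ... | inj₂ refl = ¬Tk

prime∤⇒coprime : ∀ {p n} → Prime p → ¬ p ∣ n → Coprime n p
prime∤⇒coprime pr p∤n (d∣n , d∣p) with prime⇒irreducible pr d∣p
... | inj₁ d≡1  = d≡1
... | inj₂ refl = ⊥-elim (p∤n d∣n)

∣p^a⇒≡p^b : ∀ {p n} → Prime p → ∀ a → n ∣ p ^ⁿ a → ∃ λ b → n ≡ p ^ⁿ b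
∣p^a⇒≡p^b pr zero n∣ = 0 , ∣1⇒≡1 n∣
∣p^a⇒≡p^b {p} {n} pr (suc a) n∣ with p ∣? n
... | no p∤n = ∣p^a⇒≡p^b pr a (coprime-divisor (prime∤⇒coprime pr p∤n) n∣)
... | yes (divides-refl n′) =
  let b , e = ∣p^a⇒≡p^b {n = n′} pr a (*-cancelˡ-∣ p {{prime⇒nonZero pr}} (subst (_∣ p * p ^ⁿ a) (*-comm n′ p) n∣))
  in suc b , trans (*-comm n′ p) (cong (p *_) e)

∣p^a⇒≡1⊎p∣ : ∀ {p n} → Prime p → ∀ a → n ∣ p ^ⁿ a → n ≡ 1 ⊎ p ∣ n
∣p^a⇒≡1⊎p∣ {p} pr a n∣ with ∣p^a⇒≡p^b pr a n∣
... | zero  , n≡1  = inj₁ n≡1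
... | suc b , refl = inj₂ (m∣m*n (p ^ⁿ b))

fold-preserved : ∀ {f : A → C} {σ : A → A} → (∀ i → f (σ i) ≡ f i) → ∀ i k → f (fold i σ k) ≡ f i
fold-preserved pres i zero    = refl
fold-preserved pres i (suc k) = trans (pres _) (fold-preserved pres i k)

-- All return times are described at once instead of a least one, so that periods of powers become a
-- matter of divisibility.
IsPeriod : (A → A) → A → ℕ → Set
IsPeriod σ a ℓ = ∀ j → fold a σ j ≡ a ⇔ ℓ ∣ j

module _ {σ : A → A} (σ-inj : Injective _≡_ _≡_ σ) where

  fold-inj : ∀ k → Injective _≡_ _≡_ (λ a → fold a σ k)
  fold-inj zero    e = e
  fold-inj (suc k) e = fold-inj k (σ-inj e)

  fold-suc : ∀ a k → fold (σ a) σ k ≡ σ (fold a σ k)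
  fold-suc a zero    = refl
  fold-suc a (suc k) = cong σ (fold-suc a k)

  period : DecidableEquality A → ∀ {a n} → 0 < n → fold a σ n ≡ a → ∃ λ ℓ → 0 < ℓ × IsPeriod σ a ℓ
  period _≟_ {a} = generator (λ j → fold a σ j ≟ a)
    (λ {x} {y} ex ey → trans (fold-+ a σ x {y}) (trans (cong (λ z → fold z σ x) ey) ex))
    (λ {x} {y} ex exy → fold-inj x (trans (sym (fold-+ a σ x {y})) (trans exy (sym ex))))

  orbit : A → ℕ → List A
  orbit a ℓ = map (fold a σ) (upTo ℓ)

  orbit-! : ∀ {a ℓ} → IsPeriod σ a ℓ → Unique (orbit a ℓ)
  orbit-! {a} {ℓ} per = go
    where
    apart : ∀ {i j} → i < j → j < ℓ → fold a σ i ≢ fold a σ j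
    apart {i} {j} i<j j<ℓ e with m≤n⇒∃[o]m+o≡n (<⇒≤ i<j)
    ... | zero  , refl = <-irrefl (sym (+-identityʳ i)) i<j
    ... | suc d , refl = >⇒∤ (≤-<-trans (m≤n+m (suc d) i) j<ℓ)
      (to (per (suc d)) (fold-inj i (sym (trans e (fold-+ a σ i {suc d})))))
    go : Unique (orbit a ℓ)
    go = subst Unique (sym (map-upTo (fold a σ) ℓ)) (Unique.applyUpTo⁺₁ (fold a σ) ℓ apart)

  ∈-orbit : ∀ {a ℓ} → 0 < ℓ → IsPeriod σ a ℓ → ∀ j → fold a σ j ∈ orbit a ℓ
  ∈-orbit {a} {suc ℓ} _ per j = subst (_∈ orbit a (suc ℓ)) (sym reduce-mod)
    (∈-map⁺ (fold a σ) (∈-upTo⁺ (m%n<n j (suc ℓ))))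
    where
    reduce-mod : fold a σ j ≡ fold a σ (j % suc ℓ)
    reduce-mod = trans (cong (fold a σ) (m≡m%n+[m/n]*n j (suc ℓ)))
      (trans (fold-+ a σ (j % suc ℓ) {j / suc ℓ * suc ℓ})
        (cong (λ z → fold z σ (j % suc ℓ)) (from (per _) (n∣m*n (j / suc ℓ)))))

  ∈-orbit⁻ : ∀ {a ℓ b} → b ∈ orbit a ℓ → ∃ λ j → b ≡ fold a σ j
  ∈-orbit⁻ b∈ with j , _ , e ← ∈-map⁻ _ b∈ = j , e

  orbit-closed⁻ : ∀ {a ℓ b} → 0 < ℓ → IsPeriod σ a ℓ → σ b ∈ orbit a ℓ → b ∈ orbit a ℓ
  orbit-closed⁻ {a} {suc ℓ} {b} ℓ>0 per σb∈ with ∈-orbit⁻ σb∈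
  ... | suc j , e = subst (_∈ orbit a (suc ℓ)) (sym (σ-inj e)) (∈-orbit ℓ>0 per j)
  -- The starting point a is also the image of the last point of the orbit.
  ... | zero  , e = subst (_∈ orbit a (suc ℓ)) (σ-inj (trans (from (per (suc ℓ)) ∣-refl) (sym e)))
    (∈-orbit ℓ>0 per ℓ)

  length-orbit : ∀ a ℓ → length (orbit a ℓ) ≡ ℓ
  length-orbit a ℓ = trans (length-map (fold a σ) (upTo ℓ)) (length-upTo ℓ)

  record OrbitRemoval (us : List A) (a : A) (ℓ : ℕ) : Set where
    field
      rest    : List A
      split   : us ↭ orbit a ℓ ++ rest
      rest-!  : Unique rest
      closed  : ∀ {u} → u ∈ rest → σ u ∈ rest
      rest⊆us : ∀ {u} → u ∈ rest → u ∈ us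

  removeOrbit : DecidableEquality A → ∀ {us a ℓ} → Unique us → (∀ {u} → u ∈ us → σ u ∈ us) →
    a ∈ us → 0 < ℓ → IsPeriod σ a ℓ → OrbitRemoval us a ℓ
  removeOrbit _≟_ {us} {a} {ℓ} us! cl a∈ ℓ>0 per = record
    { rest    = rest
    ; split   = unique∧set⇒↭ us! (Unique.++⁺ (orbit-! per) rest-! (λ (i , o) → proj₂ (∈-filter⁻ outside? {xs = us} o) i))
                  (λ {x} → mk⇔ (fwd x) (bwd x))
    ; rest-!  = rest-!
    ; closed  = λ u∈ → let u∈us , u∉ = ∈-filter⁻ outside? u∈ in
                  ∈-filter⁺ outside? (cl u∈us) (u∉ ∘ orbit-closed⁻ ℓ>0 per)
    ; rest⊆us = proj₁ ∘ ∈-filter⁻ outside?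
    }
    where
    open DecMembership _≟_ using (_∉?_; _∈?_)
    outside? : Decidable (_∉ orbit a ℓ)
    outside? = _∉? orbit a ℓ
    rest : List A
    rest = filter outside? us
    rest-! : Unique rest
    rest-! = Unique.filter⁺ outside? us!
    orbit⊆us : ∀ j → fold a σ j ∈ us
    orbit⊆us zero    = a∈
    orbit⊆us (suc j) = cl (orbit⊆us j)
    fwd : ∀ x → x ∈ us → x ∈ orbit a ℓ ++ rest
    fwd x x∈ with x ∈? orbit a ℓ
    ... | yes i = ∈-++⁺ˡ i
    ... | no  o = ∈-++⁺ʳ (orbit a ℓ) (∈-filter⁺ outside? x∈ o)
    bwd : ∀ x → x ∈ orbit a ℓ ++ rest → x ∈ us
    bwd x x∈ with ∈-++⁻ (orbit a ℓ) x∈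
    ... | inj₂ o = proj₁ (∈-filter⁻ outside? {xs = us} o)
    ... | inj₁ i with j , refl ← ∈-orbit⁻ i = orbit⊆us j

  -- Orbit lengths divide a power of p. An orbit of length 1 is a fixed point; any other has length
  -- divisible by p and contains no fixed point, so it counts 0 modulo p on both sides. Orbits are
  -- split off one at a time.
  fixedPoints : ∀ {p} → Prime p → (_≟_ : DecidableEquality A) → ∀ {us} a → Unique us →
    (∀ {u} → u ∈ us → σ u ∈ us) → (∀ {u} → u ∈ us → fold u σ (p ^ⁿ a) ≡ u) →
    _~_ p (length us) (length (filter (λ u → σ u ≟ u) us))
  fixedPoints {p} pr _≟_ {us} e = go (length us) us ≤-refl
    where
    fixed? : Decidable (λ u → σ u ≡ u)
    fixed? u = σ u ≟ u
    instance _ = prime⇒nonZero pr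
    orbitCase : ∀ a ℓ → IsPeriod σ a ℓ → ℓ ≡ 1 ⊎ p ∣ ℓ →
      _~_ p (length (orbit a ℓ)) (length (filter fixed? (orbit a ℓ)))
    orbitCase a ℓ per (inj₁ refl) =
      ≡⇒~ (cong length (sym (filter-all fixed? {orbit a 1} (from (per 1) ∣-refl ∷ []))))
    orbitCase a ℓ per (inj₂ p∣ℓ) =
      ~-trans (∣⇒~0 (subst (p ∣_) (sym (length-orbit a ℓ)) p∣ℓ))
        (≡⇒~ (sym (cong length (filter-none fixed? (All.tabulate moved)))))
      where
      moved : ∀ {x} → x ∈ orbit a ℓ → σ x ≢ x
      moved x∈ σx≡x with j , refl ← ∈-orbit⁻ x∈ =
        >⇒∤ (nonTrivial⇒n>1 p {{prime⇒nonTrivial pr}})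
          (∣-trans p∣ℓ (to (per 1) (fold-inj j (trans (fold-suc a j) σx≡x))))
    go : ∀ l us → length us ≤ l → Unique us → (∀ {u} → u ∈ us → σ u ∈ us) →
      (∀ {u} → u ∈ us → fold u σ (p ^ⁿ e) ≡ u) → _~_ p (length us) (length (filter fixed? us))
    go _ [] _ _ _ _ = ≡⇒~ refl
    go (suc l) us@(a ∷ us′) le us! cl tor
      with ℓ , ℓ>0 , per ← period _≟_ (>-nonZero⁻¹ (p ^ⁿ e) {{m^n≢0 p e}}) (tor (here refl)) =
      let open OrbitRemoval (removeOrbit _≟_ us! cl (here refl) ℓ>0 per)
          len : length us ≡ ℓ + length rest
          len = trans (↭-length split)
            (trans (length-++ (orbit a ℓ)) (cong (_+ length rest) (length-orbit a ℓ)))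
      in
      ~-trans (≡⇒~ (trans (↭-length split) (length-++ (orbit a ℓ))))
        (~-trans (~-+ (orbitCase a ℓ per (∣p^a⇒≡1⊎p∣ pr e (to (per _) (tor (here refl)))))
                      (go l rest (s≤s⁻¹ (≤-trans (≤-trans (+-monoˡ-≤ (length rest) ℓ>0) (≤-reflexive (sym len))) le))
                        rest-! closed (tor ∘ rest⊆us)))
          (≡⇒~ (sym (trans (↭-length (filter-↭ fixed? split))
            (trans (cong length (filter-++ fixed? (orbit a ℓ) rest)) (length-++ (filter fixed? (orbit a ℓ))))))))

-- Matching the orbits of two maps by labels

unique-map-injective : ∀ {f : A → B} {xs x y} → Unique (map f xs) → x ∈ xs → y ∈ xs → f x ≡ f y → x ≡ y
unique-map-injective _          (here refl) (here refl) e = refl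
unique-map-injective (x≢ ∷ _)   (here refl) (there y∈)  e = ⊥-elim (All.lookup x≢ (∈-map⁺ _ y∈) e)
unique-map-injective (x≢ ∷ _)   (there x∈)  (here refl) e = ⊥-elim (All.lookup x≢ (∈-map⁺ _ x∈) (sym e))
unique-map-injective (_ ∷ xs!)  (there x∈)  (there y∈)  e = unique-map-injective xs! x∈ y∈ e

countLabel : DecidableEquality C → (A → C) → List A → C → ℕ
countLabel _≟_ P us c = length (filter (λ u → c ≟ P u) us)

module _ (_≟_ : DecidableEquality C) where

  countLabel-↭ : ∀ (P : A → C) {us vs} → us ↭ vs → ∀ c → countLabel _≟_ P us c ≡ countLabel _≟_ P vs c
  countLabel-↭ P e c = ↭-length (filter-↭ (λ u → c ≟ P u) e)

  countLabel-++ : ∀ (P : A → C) us vs c →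
    countLabel _≟_ P (us ++ vs) c ≡ countLabel _≟_ P us c + countLabel _≟_ P vs c
  countLabel-++ P us vs c = trans (cong length (filter-++ (λ u → c ≟ P u) us vs)) (length-++ (filter (λ u → c ≟ P u) us))

  countLabel-map : ∀ {D : Set} {P : A → C} {Q : B → C} {f : D → A} {g : D → B} → (∀ j → P (f j) ≡ Q (g j)) →
    ∀ js c → countLabel _≟_ P (map f js) c ≡ countLabel _≟_ Q (map g js) c
  countLabel-map e [] c = refl
  countLabel-map {P = P} {Q} {f} {g} e (j ∷ js) c with c ≟ P (f j) | c ≟ Q (g j)
  ... | yes _   | yes _   = cong suc (countLabel-map e js c)
  ... | no _    | no _    = countLabel-map e js c
  ... | yes c≡P | no c≢Q  = ⊥-elim (c≢Q (trans c≡P (e j)))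
  ... | no c≢P  | yes c≡Q = ⊥-elim (c≢P (trans c≡Q (sym (e j))))

  ∃-label : ∀ {P : A → C} {us c} → 0 < countLabel _≟_ P us c → ∃ λ u → u ∈ us × c ≡ P u
  ∃-label {P = P} {us} {c} pos with filter (λ u → c ≟ P u) us in eq
  ... | x ∷ _ with x∈ , c≡ ← ∈-filter⁻ (λ u → c ≟ P u) {xs = us} (subst (x ∈_) (sym eq) (here refl)) = x , x∈ , c≡

module _
  (_≟ᴬ_ : DecidableEquality A) (_≟ᴮ_ : DecidableEquality B) (_≟ᶜ_ : DecidableEquality C)
  {σ : A → A} {τ : B → B} (σ-inj : Injective _≡_ _≡_ σ) (τ-inj : Injective _≡_ _≡_ τ)
  (P : A → C) (Q : B → C) (P-σ : ∀ a → P (σ a) ≡ P a) (Q-τ : ∀ b → Q (τ b) ≡ Q b)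
  (per : C → ℕ) (per>0 : ∀ a → 0 < per (P a))
  (perᴬ : ∀ a → IsPeriod σ a (per (P a))) (perᴮ : ∀ b → IsPeriod τ b (per (Q b)))
  where

  private
    both : A × B → A × B
    both (a , b) = σ a , τ b

  -- The graph of a label-preserving bijection, listed as pairs; `closed` says that it intertwines σ
  -- and τ.
  record Matching (us : List A) (vs : List B) : Set where
    field
      pairs  : List (A × B)
      firsts : map proj₁ pairs ↭ us
      seconds : map proj₂ pairs ↭ vs
      closed : ∀ {z} → z ∈ pairs → both z ∈ pairs
      labels : ∀ {z} → z ∈ pairs → P (proj₁ z) ≡ Q (proj₂ z)

  private
    both-inj : Injective _≡_ _≡_ both
    both-inj e = cong₂ _,_ (σ-inj (cong proj₁ e)) (τ-inj (cong proj₂ e))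
    both-fold : ∀ a b j → fold (a , b) both j ≡ (fold a σ j , fold b τ j)
    both-fold a b zero    = refl
    both-fold a b (suc j) = cong both (both-fold a b j)

  -- Equal counts provide for the first point a point b with the same label. Labels are constant on
  -- orbits and fix their length, so the two orbits can be paired pointwise from a and b on, and
  -- removing both leaves the counts equal.
  matching : ∀ {us vs} → Unique us → Unique vs →
    (∀ {u} → u ∈ us → σ u ∈ us) → (∀ {v} → v ∈ vs → τ v ∈ vs) →
    (∀ c → countLabel _≟ᶜ_ P us c ≡ countLabel _≟ᶜ_ Q vs c) → Matching us vs
  matching {us} = go (length us) us _ ≤-refl
    where
    empty : ∀ vs → (∀ c → 0 ≡ countLabel _≟ᶜ_ Q vs c) → vs ≡ []
    empty [] _ = refl
    empty (v ∷ vs) z with () ← trans (z (Q v)) (cong length (filter-accept (λ u → Q v ≟ᶜ Q u) {v} {vs} refl))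

    Goal : List A → List B → Set
    Goal us vs = Unique us → Unique vs →
      (∀ {u} → u ∈ us → σ u ∈ us) → (∀ {v} → v ∈ vs → τ v ∈ vs) →
      (∀ c → countLabel _≟ᶜ_ P us c ≡ countLabel _≟ᶜ_ Q vs c) → Matching us vs

    step : ∀ {l us vs a b} → length us ≤ suc l → (∀ us vs → length us ≤ l → Goal us vs) →
      a ∈ us → b ∈ vs → P a ≡ Q b → Goal us vs
    step {l} {us} {vs} {a} {b} le rec a∈ b∈ Pa≡Qb us! vs! cl cl′ cnt = record
      { pairs   = cycle ++ M.pairs
      ; firsts  = ↭-trans (↭-reflexive (trans (map-++ proj₁ cycle M.pairs) (cong (_++ map proj₁ M.pairs) cycle₁)))
                    (↭-trans (++⁺ ↭-refl M.firsts) (↭-sym R.split))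
      ; seconds = ↭-trans (↭-reflexive (trans (map-++ proj₂ cycle M.pairs) (cong (_++ map proj₂ M.pairs) cycle₂)))
                    (↭-trans (++⁺ ↭-refl M.seconds) (↭-sym R′.split))
      ; closed  = λ z∈ → [ (λ i → ∈-++⁺ˡ (cycle-closed i)) , (λ o → ∈-++⁺ʳ cycle (M.closed o)) ]′ (∈-++⁻ cycle z∈)
      ; labels  = λ z∈ → [ cycle-labels , M.labels ]′ (∈-++⁻ cycle z∈)
      }
      where
      ℓ : ℕ
      ℓ = per (P a)
      per-b : IsPeriod τ b ℓ
      per-b = subst (IsPeriod τ b) (cong per (sym Pa≡Qb)) (perᴮ b)
      module R = OrbitRemoval (removeOrbit σ-inj _≟ᴬ_ us! cl a∈ (per>0 a) (perᴬ a))
      module R′ = OrbitRemoval (removeOrbit τ-inj _≟ᴮ_ vs! cl′ b∈ (per>0 a) per-b)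
      shorter : length R.rest ≤ l
      shorter = s≤s⁻¹ (≤-trans (≤-trans (+-monoˡ-≤ (length R.rest) (per>0 a))
        (≤-reflexive (sym (trans (↭-length R.split) (trans (length-++ (orbit σ-inj a ℓ))
          (cong (_+ length R.rest) (length-orbit σ-inj a ℓ))))))) le)
      same-labels : ∀ j → P (fold a σ j) ≡ Q (fold b τ j)
      same-labels j = trans (fold-preserved P-σ a j) (trans Pa≡Qb (sym (fold-preserved Q-τ b j)))
      rest-counts : ∀ c → countLabel _≟ᶜ_ P R.rest c ≡ countLabel _≟ᶜ_ Q R′.rest c
      rest-counts c = +-cancelˡ-≡ (countLabel _≟ᶜ_ P (orbit σ-inj a ℓ) c) _ _ (begin
          countLabel _≟ᶜ_ P (orbit σ-inj a ℓ) c + countLabel _≟ᶜ_ P R.rest c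
            ≡⟨ countLabel-++ _≟ᶜ_ P (orbit σ-inj a ℓ) R.rest c ⟨
          countLabel _≟ᶜ_ P (orbit σ-inj a ℓ ++ R.rest) c
            ≡⟨ countLabel-↭ _≟ᶜ_ P R.split c ⟨
          countLabel _≟ᶜ_ P us c
            ≡⟨ cnt c ⟩
          countLabel _≟ᶜ_ Q vs c
            ≡⟨ countLabel-↭ _≟ᶜ_ Q R′.split c ⟩
          countLabel _≟ᶜ_ Q (orbit τ-inj b ℓ ++ R′.rest) c
            ≡⟨ countLabel-++ _≟ᶜ_ Q (orbit τ-inj b ℓ) R′.rest c ⟩
          countLabel _≟ᶜ_ Q (orbit τ-inj b ℓ) c + countLabel _≟ᶜ_ Q R′.rest c
            ≡⟨ cong (_+ countLabel _≟ᶜ_ Q R′.rest c) (countLabel-map _≟ᶜ_ same-labels (upTo ℓ) c) ⟨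
          countLabel _≟ᶜ_ P (orbit σ-inj a ℓ) c + countLabel _≟ᶜ_ Q R′.rest c ∎)
        where open ≡-Reasoning
      module M = Matching (rec R.rest R′.rest shorter R.rest-! R′.rest-! R.closed R′.closed rest-counts)
      cycle : List (A × B)
      cycle = map (λ j → fold a σ j , fold b τ j) (upTo ℓ)
      cycle₁ : map proj₁ cycle ≡ orbit σ-inj a ℓ
      cycle₁ = sym (map-∘ (upTo ℓ))
      cycle₂ : map proj₂ cycle ≡ orbit τ-inj b ℓ
      cycle₂ = sym (map-∘ (upTo ℓ))
      -- The paired cycle is the orbit of `(a , b)` under `both`, whose period is again `ℓ`.
      cycle-closed : ∀ {z} → z ∈ cycle → both z ∈ cycle
      cycle-closed z∈ with j , _ , refl ← ∈-map⁻ _ z∈ =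
        subst (_∈ cycle) (both-fold a b (suc j))
          (subst (fold (a , b) both (suc j) ∈_) (map-cong (both-fold a b) (upTo ℓ))
            (∈-orbit both-inj (per>0 a) per-both (suc j)))
        where
        per-both : IsPeriod both (a , b) ℓ
        per-both j = mk⇔
          (λ e → to (perᴬ a j) (cong proj₁ (trans (sym (both-fold a b j)) e)))
          (λ d → trans (both-fold a b j) (cong₂ _,_ (from (perᴬ a j) d) (from (per-b j) d)))
      cycle-labels : ∀ {z} → z ∈ cycle → P (proj₁ z) ≡ Q (proj₂ z)
      cycle-labels z∈ with j , _ , refl ← ∈-map⁻ _ z∈ = same-labels j

    go : ∀ l us vs → length us ≤ l → Goal us vs
    go _ [] vs _ _ _ _ _ cnt with refl ← empty vs cnt = record
      { pairs = [] ; firsts = ↭-refl ; seconds = ↭-refl ; closed = λ () ; labels = λ () }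
    go (suc l) us@(a ∷ us′) vs le us! vs! cl cl′ cnt
      with b , b∈ , Pa≡Qb ← ∃-label _≟ᶜ_ {P = Q} {vs} {P a}
             (subst (0 <_) (cnt (P a)) (≤-trans z<s (≤-reflexive
               (sym (cong length (filter-accept (λ u → P a ≟ᶜ P u) {a} {us′} refl)))))) =
      step le (go l) (here refl) b∈ Pa≡Qb us! vs! cl cl′ cnt

module _ {n : ℕ} {σ τ : Fin n → Fin n} {C : Set} (_≟ᶜ_ : DecidableEquality C)
  (σ-inj : Injective _≡_ _≡_ σ) (τ-inj : Injective _≡_ _≡_ τ)
  (P Q : Fin n → C) (P-σ : ∀ a → P (σ a) ≡ P a) (Q-τ : ∀ b → Q (τ b) ≡ Q b)
  (per : C → ℕ) (per>0 : ∀ a → 0 < per (P a))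
  (perᴬ : ∀ a → IsPeriod σ a (per (P a))) (perᴮ : ∀ b → IsPeriod τ b (per (Q b)))
  (counts : ∀ c → countLabel _≟ᶜ_ P (allFin n) c ≡ countLabel _≟ᶜ_ Q (allFin n) c)
  where

  -- Both projections of the matched pairs are rearrangements of `allFin n`, hence free of
  -- repetitions, so each coordinate determines the other. With cycle lengths as labels this is the
  -- classical conjugacy criterion for permutations; with σ and τ the identity it carries one
  -- colouring to another.
  intertwiner : ∃ λ (π : Permutation′ n) →
    (∀ i → π ⟨$⟩ʳ (σ i) ≡ τ (π ⟨$⟩ʳ i)) × (∀ i → Q (π ⟨$⟩ʳ i) ≡ P i)
  intertwiner = permutation f g f∘g g∘f
    , (λ i → functional (f-pair (σ i)) (closed (f-pair i)) refl)
    , (λ i → sym (labels (f-pair i)))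
    where
    open Matching (matching Fin._≟_ Fin._≟_ _≟ᶜ_ σ-inj τ-inj P Q P-σ Q-τ per per>0 perᴬ perᴮ
      (Unique.allFin⁺ n) (Unique.allFin⁺ n) (λ _ → ∈-allFin _) (λ _ → ∈-allFin _) counts)
    unique : ∀ {xs : List (Fin n)} → xs ↭ allFin n → Unique xs
    unique e = Unique-resp-↭ (setoid _) (↭⇒↭ₛ (↭-sym e)) (Unique.allFin⁺ n)
    functional : ∀ {i i′ j j′} → (i , j) ∈ pairs → (i′ , j′) ∈ pairs → i ≡ i′ → j ≡ j′
    functional z∈ z′∈ e = cong proj₂ (unique-map-injective (unique firsts) z∈ z′∈ e)
    injective : ∀ {i i′ j j′} → (i , j) ∈ pairs → (i′ , j′) ∈ pairs → j ≡ j′ → i ≡ i′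
    injective z∈ z′∈ e = cong proj₁ (unique-map-injective (unique seconds) z∈ z′∈ e)
    forth : ∀ i → ∃ λ j → (i , j) ∈ pairs
    forth i with (_ , j) , z∈ , refl ← ∈-map⁻ proj₁ (∈-resp-↭ (↭-sym firsts) (∈-allFin i)) = j , z∈
    back : ∀ j → ∃ λ i → (i , j) ∈ pairs
    back j with (i , _) , z∈ , refl ← ∈-map⁻ proj₂ (∈-resp-↭ (↭-sym seconds) (∈-allFin j)) = i , z∈
    f g : Fin n → Fin n
    f = proj₁ ∘ forth
    g = proj₁ ∘ back
    f-pair : ∀ i → (i , f i) ∈ pairs
    f-pair = proj₂ ∘ forth
    f∘g : ∀ j → f (g j) ≡ j
    f∘g j = functional (f-pair (g j)) (proj₂ (back j)) refl
    g∘f : ∀ i → g (f i) ≡ i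
    g∘f i = injective (proj₂ (back (f i))) (f-pair i) refl

-- Block structure of parabolic subgroups and Coxeter elements

infix 4 _PreservedBy_
_PreservedBy_ : (Fin n → C) → Permutation′ n → Set
f PreservedBy π = ∀ i → f (π ⟨$⟩ʳ i) ≡ f i

_ConstantOn_ : (Fin (suc m) → C) → Subset m → Set
f ConstantOn J = ∀ i → i ∈ₛ J → f (inject₁ i) ≡ f (suc i)

perm-injective : (π : Permutation′ n) → Injective _≡_ _≡_ (π ⟨$⟩ʳ_)
perm-injective π {i} {j} e = trans (sym (Perm.inverseˡ π)) (trans (cong (π ⟨$⟩ˡ_) e) (Perm.inverseˡ π))

returns : (π : Permutation′ n) (i : Fin n) → ∃ λ N → 0 < N × N ≤ n × fold i (π ⟨$⟩ʳ_) N ≡ i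
returns {n} π i with Fin.pigeonhole (n<1+n n) (λ j → fold i (π ⟨$⟩ʳ_) (toℕ j))
... | a , b , a<b , e with m≤n⇒∃[o]m+o≡n (<⇒≤ a<b)
...   | d , a+d≡b = d , d>0 , ≤-trans (≤-trans (m≤n+m d (toℕ a)) (≤-reflexive a+d≡b)) (s≤s⁻¹ (Fin.toℕ<n b)) ,
  fold-inj (perm-injective π) (toℕ a)
    (trans (sym (fold-+ i (π ⟨$⟩ʳ_) (toℕ a) {d})) (trans (cong (fold i (π ⟨$⟩ʳ_)) a+d≡b) (sym e)))
  where
  d>0 : 0 < d
  d>0 = +-cancelˡ-< (toℕ a) 0 d (subst₂ _<_ (sym (+-identityʳ _)) (sym a+d≡b) a<b)

s-left : ∀ (i : Fin m) → s i ⟨$⟩ʳ inject₁ i ≡ suc i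
s-left i rewrite dec-yes (inject₁ i Fin.≟ inject₁ i) refl .proj₂ = refl

s-right : ∀ (i : Fin m) → s i ⟨$⟩ʳ suc i ≡ inject₁ i
s-right i with suc i Fin.≟ inject₁ i
... | yes e = e
... | no  _ rewrite dec-yes (i Fin.≟ i) refl .proj₂ = refl

s-other : ∀ {i : Fin m} {k} → k ≢ inject₁ i → k ≢ suc i → s i ⟨$⟩ʳ k ≡ k
s-other {i = i} {k} k≢ k≢′ rewrite dec-no (k Fin.≟ inject₁ i) k≢ | dec-no (k Fin.≟ suc i) k≢′ = refl

s-preserves : ∀ {f : Fin (suc m) → C} {i} → f (inject₁ i) ≡ f (suc i) → f PreservedBy s i
s-preserves {f = f} {i} e k = cases (k Fin.≟ inject₁ i) (k Fin.≟ suc i)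
  where
  cases : Dec (k ≡ inject₁ i) → Dec (k ≡ suc i) → f (s i ⟨$⟩ʳ k) ≡ f k
  cases (yes refl) _          = trans (cong f (s-left i)) (sym e)
  cases (no _)     (yes refl) = trans (cong f (s-right i)) e
  cases (no k≢)    (no k≢′)   = cong f (s-other k≢ k≢′)

-- The index of the J-block containing a point, blocks being numbered from left to right.
block : Subset m → Fin (suc m) → ℕ
block J           zero    = 0
block (true ∷ J)  (suc i) = block J i
block (false ∷ J) (suc i) = suc (block J i)

block-constant : (J : Subset m) → block J ConstantOn J
block-constant (true ∷ J)  zero    _          = refl
block-constant (true ∷ J)  (suc i) (there i∈) = block-constant J i i∈
block-constant (false ∷ J) (suc i) (there i∈) = cong suc (block-constant J i i∈)

block-step⇒∈ : (J : Subset m) → ∀ i → block J (inject₁ i) ≡ block J (suc i) → i ∈ₛ J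
block-step⇒∈ (true ∷ J)  zero    e = here
block-step⇒∈ (true ∷ J)  (suc i) e = there (block-step⇒∈ J i e)
block-step⇒∈ (false ∷ J) (suc i) e = there (block-step⇒∈ J i (suc-injective e))

block-mono : (J : Subset m) → ∀ {i j} → toℕ i ≤ toℕ j → block J i ≤ block J j
block-mono J           {zero}          _         = z≤n
block-mono (true ∷ J)  {suc i} {suc j} (s≤s i≤j) = block-mono J i≤j
block-mono (false ∷ J) {suc i} {suc j} (s≤s i≤j) = s≤s (block-mono J i≤j)

constant-on-blocks : ∀ {J : Subset m} {f : Fin (suc m) → C} → f ConstantOn J →
  ∀ i j → block J i ≡ block J j → f i ≡ f j
constant-on-blocks             fc zero    zero    e = refl
constant-on-blocks {J = true ∷ J}  {f} fc zero (suc j) e =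
  trans (fc zero here) (constant-on-blocks {J = J} {f ∘ suc} (λ k k∈ → fc (suc k) (there k∈)) zero j e)
constant-on-blocks {J = true ∷ J}  {f} fc (suc i) zero e =
  trans (constant-on-blocks {J = J} {f ∘ suc} (λ k k∈ → fc (suc k) (there k∈)) i zero e) (sym (fc zero here))
constant-on-blocks {J = true ∷ J}  {f} fc (suc i) (suc j) e =
  constant-on-blocks {J = J} {f ∘ suc} (λ k k∈ → fc (suc k) (there k∈)) i j e
constant-on-blocks {J = false ∷ J} {f} fc (suc i) (suc j) e =
  constant-on-blocks {J = J} {f ∘ suc} (λ k k∈ → fc (suc k) (there k∈)) i j (suc-injective e)

module _ {m : ℕ} where
  open Group (symmetricGroup (suc m)) using (_∙_; ε; _⁻¹)
  open GroupTheory (symmetricGroup (suc m))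

  parabolic-preserves : ∀ {J : Subset m} {f : Fin (suc m) → C} {π} → f ConstantOn J → Parabolic J π → f PreservedBy π
  parabolic-preserves {J = J} {f} fc = go
    where
    go : ∀ {π} → Parabolic J π → f PreservedBy π
    go (gen (i , i∈ , e)) k = trans (cong f (e k)) (s-preserves {f = f} {i} (fc i i∈) k)
    go one                k = refl
    go (mul {y = y} p q)  k = trans (go p (y ⟨$⟩ʳ k)) (go q k)
    go (inv {x} p)        k = trans (sym (go p (x ⟨$⟩ˡ k))) (cong f (Perm.inverseʳ x))
    go (resp e p)         k = trans (cong f (sym (e k))) (go p k)

  private
    FixesFrom : ℕ → Permutation′ (suc m) → Set
    FixesFrom d π = ∀ i → d ≤ toℕ i → π ⟨$⟩ʳ i ≡ i

  -- Bubble sort: the largest moved point is carried home by simple reflections inside its block.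
  preserves⇒parabolic : ∀ {J : Subset m} {π} → block J PreservedBy π → Parabolic J π
  preserves⇒parabolic {J} {π} pres = outer (suc m) ≤-refl π pres (λ i ge → ⊥-elim (<⇒≱ (Fin.toℕ<n i) ge))
    where
    outer : ∀ d → d ≤ suc m → ∀ π → block J PreservedBy π → FixesFrom d π → Parabolic J π
    -- `k` is the distance that the image of the point d still has to travel to reach d.
    inner : ∀ k {d} (d<n : d < suc m) π → block J PreservedBy π → FixesFrom (suc d) π →
      toℕ (π ⟨$⟩ʳ fromℕ< d<n) + k ≡ d → Parabolic J π

    outer zero    _   π pres fix = resp (λ i → sym (fix i z≤n)) one
    outer (suc d) d<n π pres fix =
      let k , e = m≤n⇒∃[o]m+o≡n image≤d in inner k d<n π pres fix e
      where
      x = fromℕ< d<n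
      image≤d : toℕ (π ⟨$⟩ʳ x) ≤ d
      image≤d with toℕ (π ⟨$⟩ʳ x) ≤? d
      ... | yes le = le
      -- A larger image would be a fixed point of π, hence equal to x by injectivity.
      ... | no nle = ≤-reflexive (trans
        (cong toℕ (perm-injective π (fix (π ⟨$⟩ʳ x) (≰⇒> nle)))) (Fin.toℕ-fromℕ< d<n))

    inner zero {d} d<n π pres fix e = outer d (<⇒≤ d<n) π pres fix′
      where
      fix′ : FixesFrom d π
      fix′ i d≤i with m≤n⇒m<n∨m≡n d≤i
      ... | inj₁ d<i  = fix i d<i
      ... | inj₂ d≡i = Fin.toℕ-injective (trans (cong (λ z → toℕ (π ⟨$⟩ʳ z)) i≡x)
              (trans (sym (+-identityʳ _)) (trans e d≡i)))
        where
        i≡x : i ≡ fromℕ< d<n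
        i≡x = Fin.toℕ-injective (trans (sym d≡i) (sym (Fin.toℕ-fromℕ< d<n)))
    inner (suc k) {d} d<n π pres fix e = resp {x = s i ⁻¹ ∙ (s i ∙ π)} (λ j → Perm.inverseˡ (s i))
      (mul (inv {x = s i} (gen (i , i∈J , λ _ → refl)))
      (inner k d<n (s i ∙ π) pres′ fix′ e′))
      where
      x = fromℕ< d<n
      y = π ⟨$⟩ʳ x
      y<d : toℕ y < d
      y<d = ≤-trans (m<m+n (toℕ y) z<s) (≤-reflexive e)
      y<m : toℕ y < m
      y<m = <-≤-trans y<d (s≤s⁻¹ d<n)
      i : Fin m
      i = fromℕ< y<m
      y≡ : y ≡ inject₁ i
      y≡ = Fin.toℕ-injective (sym (trans (Fin.toℕ-inject₁ i) (Fin.toℕ-fromℕ< y<m)))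
      1+i≤d : toℕ (suc i) ≤ d
      1+i≤d = ≤-trans (≤-reflexive (cong suc (Fin.toℕ-fromℕ< y<m))) y<d
      -- π keeps x in its block, and block numbers are monotone; the right neighbour of y lies
      -- between y and x and so shares their block.
      i∈J : i ∈ₛ J
      i∈J = block-step⇒∈ J i (≤-antisym
        (block-mono J (≤-trans (≤-reflexive (Fin.toℕ-inject₁ i)) (n≤1+n _)))
        (≤-trans (block-mono J (≤-trans 1+i≤d (≤-reflexive (sym (Fin.toℕ-fromℕ< d<n)))))
          (≤-reflexive (trans (sym (pres x)) (cong (block J) y≡)))))
      pres′ : block J PreservedBy (s i ∙ π)
      pres′ j = trans (s-preserves {f = block J} {i} (block-constant J i i∈J) (π ⟨$⟩ʳ j)) (pres j)
      fix′ : FixesFrom (suc d) (s i ∙ π)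
      fix′ j d<j = trans (cong (s i ⟨$⟩ʳ_) (fix j d<j))
        (s-other (λ { refl → <⇒≱ (≤-<-trans 1+i≤d d<j) (≤-trans (≤-reflexive (Fin.toℕ-inject₁ i)) (n≤1+n _)) })
                 (λ { refl → <⇒≱ d<j 1+i≤d }))
      e′ : toℕ (s i ⟨$⟩ʳ y) + k ≡ d
      e′ = trans (cong (λ z → toℕ z + k) (trans (cong (s i ⟨$⟩ʳ_) y≡) (s-left i)))
        (trans (cong (λ z → suc z + k) (Fin.toℕ-fromℕ< y<m)) (trans (sym (+-suc (toℕ y) k)) e))

  word : List (Fin m) → Permutation′ (suc m)
  word is = foldr _∙_ ε (map s is)

  word-preserves : ∀ {f : Fin (suc m) → C} is → (∀ {i} → i ∈ is → f (inject₁ i) ≡ f (suc i)) → f PreservedBy word is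
  word-preserves []       h k = refl
  word-preserves {f = f} (i ∷ is) h k =
    trans (s-preserves {f = f} {i} (h (here refl)) _) (word-preserves is (h ∘ there) k)

  -- The letters other than i preserve the set of points to the right of i, so the orbit of
  -- i + 1 under their product w avoids i; it returns to i + 1, where s i links it to i.
  word-constant : DecidableEquality C → ∀ {f : Fin (suc m) → C} is → Unique is → f PreservedBy word is →
    ∀ {i} → i ∈ is → f (inject₁ i) ≡ f (suc i)
  word-constant _≟_ {f} (i ∷ is) (i≢ ∷ is!) pres = λ where
      (here refl) → link
      -- Once f agrees at the two points that `s i` swaps, `s i` preserves f and can be stripped off
      -- the word.
      (there j∈)  → word-constant _≟_ is is! (λ k → trans (sym (s-preserves {f = f} {i} link _)) (pres k)) j∈
    where
    w = word is
    right : Fin (suc m) → Bool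
    right k = does (suc (toℕ i) ≤? toℕ k)
    does-cong : ∀ {P Q : Set} (P? : Dec P) (Q? : Dec Q) → (P → Q) → (Q → P) → does P? ≡ does Q?
    does-cong (yes _) (yes _) _ _ = refl
    does-cong (no _)  (no _)  _ _ = refl
    does-cong (yes p) (no ¬q) f _ = ⊥-elim (¬q (f p))
    does-cong (no ¬p) (yes q) _ g = ⊥-elim (¬p (g q))
    right-preserved : right PreservedBy w
    right-preserved = word-preserves is λ {j} j∈ → does-cong (toℕ i <? toℕ (inject₁ j)) (toℕ i <? suc (toℕ j))
      (λ i<j → m≤n⇒m≤1+n (subst (suc (toℕ i) ≤_) (Fin.toℕ-inject₁ j) i<j))
      (λ i<1+j → subst (suc (toℕ i) ≤_) (sym (Fin.toℕ-inject₁ j))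
        (≤∧≢⇒< (s≤s⁻¹ i<1+j) (All.lookup i≢ j∈ ∘ Fin.toℕ-injective)))
    left≢ : ∀ {k} → right k ≡ true → k ≢ inject₁ i
    left≢ r refl = <-irrefl (sym (Fin.toℕ-inject₁ i)) (<ᵇ⇒< _ _ (subst Bool.T (sym r) tt))
    right-b : right (suc i) ≡ true
    right-b = dec-true (suc (toℕ i) ≤? suc (toℕ i)) ≤-refl

    module _ (fa≢fb : f (inject₁ i) ≢ f (suc i)) where
      x : ℕ → Fin (suc m)
      x = fold (suc i) (w ⟨$⟩ʳ_)
      x-right : ∀ k → right (x k) ≡ true
      x-right zero    = right-b
      x-right (suc k) = trans (right-preserved (x k)) (x-right k)
      f-x : ∀ k → f (x k) ≡ f (suc i)
      x≢ : ∀ k → x (suc k) ≢ suc i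
      -- `s i` would carry the returning point to `inject₁ i`, and invariance of f would give f
      -- there the value at `x k`, which is the value at `suc i`.
      x≢ k e = fa≢fb (trans (sym (trans (cong (λ z → f (s i ⟨$⟩ʳ z)) e) (cong f (s-right i)))) (trans (pres (x k)) (f-x k)))
      f-x zero    = refl
      f-x (suc k) = trans (sym (trans (sym (pres (x k)))
        (cong f (s-other (left≢ (x-right (suc k))) (x≢ k))))) (f-x k)

      absurd : (∃ λ N → 0 < N × N ≤ suc m × x N ≡ suc i) → ⊥
      absurd (suc N , _ , _ , e) = x≢ N e

    link : f (inject₁ i) ≡ f (suc i)
    link with f (inject₁ i) ≟ f (suc i)
    ... | yes e = e
    ... | no ne = ⊥-elim (absurd ne (returns w (suc i)))

  -- The order of the letters has disappeared here; everything below uses Coxeter elements only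
  -- through this criterion, for varying colours.
  coxeter-preserves⇔constant : DecidableEquality C → ∀ {K : Subset m} {c} → IsCoxeterElement K c →
    ∀ {f : Fin (suc m) → C} → f PreservedBy c ⇔ f ConstantOn K
  coxeter-preserves⇔constant _≟_ (is , is! , is⇔K , c≈) {f} = mk⇔
    (λ pres i i∈ → word-constant _≟_ is is! (λ k → trans (cong f (sym (c≈ k))) (pres k)) (from (is⇔K i) i∈))
    (λ fc k → trans (cong f (c≈ k)) (word-preserves is (λ i∈ → fc _ (to (is⇔K _) i∈)) k))

-- Cosets as colourings

-- φ is a complete invariant of the classes of R, so it sends the representatives kept by
-- `deduplicate` bijectively to the members of `ys`.
length-deduplicate-filter : ∀ {R : Rel A 0ℓ} {P : Pred A 0ℓ} (R? : Binary.Decidable R) (P? : Decidable P) (φ : A → D) →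
  (∀ x y → R x y ⇔ φ x ≡ φ y) → ∀ xs {ys} → Unique ys →
  (∀ {y} → y ∈ ys → ∃ λ x → x ∈ xs × P x × y ≡ φ x) → (∀ x → P x → φ x ∈ ys) →
  length (deduplicate R? (filter P? xs)) ≡ length ys
length-deduplicate-filter {R = R} R? P? φ R⇔ xs {ys} ys! ys⇒ ⇒ys =
  trans (sym (length-map φ (deduplicate R? zs))) (↭-length (unique∧set⇒↭ (unique zs) ys! (mk⇔ fwd bwd)))
  where
  unrelated : ∀ xs → AllPairs (λ x y → ¬ R x y) (deduplicate R? xs)
  unrelated []       = []
  unrelated (x ∷ xs) = All.all-filter (¬? ∘ R? x) (deduplicate R? xs) ∷ AllPairs.filter⁺ (¬? ∘ R? x) (unrelated xs)
  unique : ∀ xs → Unique (map φ (deduplicate R? xs))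
  unique xs = AllPairs.map⁺ (AllPairs.map (_∘ from (R⇔ _ _)) (unrelated xs))
  zs = filter P? xs
  fwd : ∀ {y} → y ∈ map φ (deduplicate R? zs) → y ∈ ys
  fwd y∈ with x , x∈ , refl ← ∈-map⁻ φ y∈ = ⇒ys x (proj₂ (∈-filter⁻ P? {xs = xs} (∈-deduplicate⁻ R? zs x∈)))
  bwd : ∀ {y} → y ∈ ys → y ∈ map φ (deduplicate R? zs)
  bwd {y} y∈ with x , x∈ , Px , refl ← ys⇒ y∈ =
    Any.map⁺ (Any.deduplicate⁺ R? (λ e e′ → trans e′ (sym (to (R⇔ _ _) e))) (Any.map (cong φ) (∈-filter⁺ P? x∈ Px)))

module Colourings (_≟_ : DecidableEquality C) (κ : Fin n → C) where

  _≟ᵛ_ : DecidableEquality (Vec C n)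
  _≟ᵛ_ = ≡-dec _≟_

  -- Vectors rather than functions, so that equality is decidable and colourings can be listed
  -- without repetition. Two permutations give the same colouring exactly when they lie in the same
  -- left coset of the stabiliser of `κ`.
  colouring : Permutation′ n → Vec C n
  colouring h = tabulate (λ i → κ (h ⟨$⟩ˡ i))

  colourings : List (Vec C n)
  colourings = deduplicate _≟ᵛ_ (map colouring (permutations n))

  colouring-cong : ∀ {g h : Permutation′ n} → g Perm.≈ h → colouring g ≡ colouring h
  colouring-cong {g} {h} e = tabulate-cong λ i → cong κ (Group.⁻¹-cong (symmetricGroup n) {g} {h} e i)

  ∈-permutations : ∀ h → ∃ λ h′ → h′ ∈ permutations n × h Perm.≈ h′
  ∈-permutations h = find (permutations-complete n h)

  ∈-colourings : ∀ {v} → v ∈ colourings ⇔ (∃ λ h → v ≡ colouring h)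
  ∈-colourings {v} = mk⇔
    (λ v∈ → let h , _ , e = ∈-map⁻ colouring (∈-deduplicate⁻ _≟ᵛ_ (map colouring (permutations n)) v∈) in h , e)
    (λ { (h , refl) → let h′ , h′∈ , e = ∈-permutations h in
      ∈-deduplicate⁺ _≟ᵛ_ (subst (_∈ map colouring (permutations n)) (sym (colouring-cong {h} {h′} e)) (∈-map⁺ colouring h′∈)) })

  lookup-colouring : ∀ h i → lookup (colouring h) i ≡ κ (h ⟨$⟩ˡ i)
  lookup-colouring h = lookup∘tabulate _

  -- Composition with w, that is, the action of the inverse of w; both fix the same colourings.
  act : Permutation′ n → Vec C n → Vec C n
  act w v = tabulate (λ i → lookup v (w ⟨$⟩ʳ i))

  lookup-act : ∀ w v i → lookup (act w v) i ≡ lookup v (w ⟨$⟩ʳ i)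
  lookup-act w v = lookup∘tabulate _

  lookup-ext : ∀ {v w : Vec C n} → (∀ i → lookup v i ≡ lookup w i) → v ≡ w
  lookup-ext {v} {w} e = trans (sym (tabulate∘lookup v)) (trans (tabulate-cong e) (tabulate∘lookup w))

  act-fixed : ∀ w {v} → act w v ≡ v ⇔ lookup v PreservedBy w
  act-fixed w {v} = mk⇔
    (λ e i → trans (sym (lookup-act w v i)) (cong (λ z → lookup z i) e))
    (λ pres → lookup-ext λ i → trans (lookup-act w v i) (pres i))

  act-injective : ∀ w → Injective _≡_ _≡_ (act w)
  act-injective w {u} {v} e = lookup-ext λ i →
    trans (cong (lookup u) (sym (Perm.inverseʳ w)))
      (trans (sym (lookup-act w u _)) (trans (cong (λ z → lookup z (w ⟨$⟩ˡ i)) e)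
        (trans (lookup-act w v _) (cong (lookup v) (Perm.inverseʳ w)))))

  lookup-fold-act : ∀ w v k i → lookup (fold v (act w) k) i ≡ lookup v (fold i (w ⟨$⟩ʳ_) k)
  lookup-fold-act w v zero    i = refl
  lookup-fold-act w v (suc k) i = trans (lookup-act w (fold v (act w) k) i)
    (trans (lookup-fold-act w v k (w ⟨$⟩ʳ i)) (cong (lookup v) (fold-suc (perm-injective w) i k)))

  act-colourings : ∀ w {v} → v ∈ colourings → act w v ∈ colourings
  act-colourings w v∈ with h , refl ← to ∈-colourings v∈ =
    from ∈-colourings (h Perm.∘ₚ Perm.flip w , tabulate-cong λ i → lookup-colouring h (w ⟨$⟩ʳ i))

  fixed? : ∀ w → Decidable (λ v → act w v ≡ v)
  fixed? w v = act w v ≟ᵛ v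

  fixedColourings : Permutation′ n → List (Vec C n)
  fixedColourings w = filter (fixed? w) colourings

  fixedColourings-! : ∀ w → Unique (fixedColourings w)
  fixedColourings-! w = Unique.filter⁺ (fixed? w) (UniqueDec.deduplicate-! _≟ᵛ_ (map colouring (permutations n)))

  ∈-fixedColourings : ∀ w {v} → v ∈ fixedColourings w ⇔ (v ∈ colourings × lookup v PreservedBy w)
  ∈-fixedColourings w = mk⇔
    (λ v∈ → let v∈′ , e = ∈-filter⁻ (fixed? w) {xs = colourings} v∈ in v∈′ , to (act-fixed w) e)
    (λ (v∈ , pres) → ∈-filter⁺ (fixed? w) v∈ (from (act-fixed w) pres))

  -- From g x = y g it follows that composition with g turns invariance under y into invariance
  -- under x; composition with the inverse of g goes back.
  conjugate-fixedColourings : ∀ {x y} → GroupTheory.Conjugate (symmetricGroup n) x y →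
    length (fixedColourings x) ≡ length (fixedColourings y)
  conjugate-fixedColourings {x} {y} (g , e) = sym (trans (sym (length-map (act g) (fixedColourings y)))
    (↭-length (unique∧set⇒↭ (Unique.map⁺ (act-injective g) (fixedColourings-! y)) (fixedColourings-! x) (mk⇔ fwd bwd))))
    where
    gx≡yg : ∀ i → g ⟨$⟩ʳ (x ⟨$⟩ʳ i) ≡ y ⟨$⟩ʳ (g ⟨$⟩ʳ i)
    gx≡yg i = trans (cong (λ z → g ⟨$⟩ʳ (x ⟨$⟩ʳ z)) (sym (Perm.inverseˡ g))) (e (g ⟨$⟩ʳ i))
    fwd : ∀ {v} → v ∈ map (act g) (fixedColourings y) → v ∈ fixedColourings x
    fwd v∈ with u , u∈ , refl ← ∈-map⁻ (act g) v∈ with u∈′ , pres ← to (∈-fixedColourings y) u∈ =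
      from (∈-fixedColourings x) (act-colourings g u∈′ , λ i → trans (lookup-act g u _)
        (trans (cong (lookup u) (gx≡yg i)) (trans (pres _) (sym (lookup-act g u i)))))
    bwd : ∀ {v} → v ∈ fixedColourings x → v ∈ map (act g) (fixedColourings y)
    bwd {v} v∈ with v∈′ , pres ← to (∈-fixedColourings x) v∈ =
      subst (_∈ map (act g) (fixedColourings y))
        (lookup-ext λ i → trans (lookup-act g (act (Perm.flip g) v) i)
          (trans (lookup-act (Perm.flip g) v _) (cong (lookup v) (Perm.inverseˡ g))))
        (∈-map⁺ (act g) (from (∈-fixedColourings y) (act-colourings (Perm.flip g) v∈′ , λ i →
          trans (lookup-act (Perm.flip g) v _) (trans (cong (lookup v) (move i))
            (trans (pres _) (sym (lookup-act (Perm.flip g) v i)))))))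
      where
      move : ∀ i → g ⟨$⟩ˡ (y ⟨$⟩ʳ i) ≡ x ⟨$⟩ʳ (g ⟨$⟩ˡ i)
      move i = trans (cong (λ z → g ⟨$⟩ˡ (y ⟨$⟩ʳ z)) (sym (Perm.inverseʳ g)))
        (trans (cong (g ⟨$⟩ˡ_) (sym (gx≡yg _))) (Perm.inverseˡ g))

-- Colourings fixed by a permutation and by its p-regular part

fold-∘ : ∀ {f g h : A → A} → (∀ a → h a ≡ f (g a)) → (∀ a → f (g a) ≡ g (f a)) →
  ∀ a k → fold a h k ≡ fold (fold a g k) f k
fold-∘ {f = f} {g} {h} h≡ comm a zero    = refl
fold-∘ {f = f} {g} {h} h≡ comm a (suc k) = trans (cong h (fold-∘ h≡ comm a k))
  (trans (h≡ _) (cong f (past (fold a g k) k)))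
  where
  past : ∀ a k → g (fold a f k) ≡ fold (g a) f k
  past a zero    = refl
  past a (suc k) = trans (sym (comm _)) (cong f (past a k))

module _ (n : ℕ) where
  open GroupTheory (symmetricGroup n)

  ^-fold : ∀ x k i → (x ^ k) ⟨$⟩ʳ i ≡ fold i (x ⟨$⟩ʳ_) k
  ^-fold x zero    i = refl
  ^-fold x (suc k) i = cong (x ⟨$⟩ʳ_) (^-fold x k i)

  module _ {p : ℕ} (pr : Prime p) (_≟_ : DecidableEquality C) where

    module _ {x x′ : Permutation′ n} (reg : IsRegularPart p x x′) where
      private
        x″ = proj₁ reg
        x≡x′x″ : ∀ i → x ⟨$⟩ʳ i ≡ x′ ⟨$⟩ʳ (x″ ⟨$⟩ʳ i)
        x≡x′x″ = proj₁ (proj₂ reg)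
        x≡x″x′ : ∀ i → x ⟨$⟩ʳ i ≡ x″ ⟨$⟩ʳ (x′ ⟨$⟩ʳ i)
        x≡x″x′ = proj₁ (proj₂ (proj₂ reg))
        k = proj₁ (proj₁ (proj₂ (proj₂ (proj₂ reg))))
        order′ : HasOrder x′ k
        order′ = proj₁ (proj₂ (proj₁ (proj₂ (proj₂ (proj₂ reg)))))
        k-coprime : Coprime k p
        k-coprime = proj₂ (proj₂ (proj₁ (proj₂ (proj₂ (proj₂ reg)))))
        a = proj₁ (proj₂ (proj₂ (proj₂ (proj₂ reg))))
        order″ : HasOrder x″ (p ^ⁿ a)
        order″ = proj₂ (proj₂ (proj₂ (proj₂ (proj₂ reg))))

        power-p^a : ∀ i → fold i (x ⟨$⟩ʳ_) (p ^ⁿ a) ≡ fold i (x′ ⟨$⟩ʳ_) (p ^ⁿ a)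
        power-p^a i = trans (fold-∘ x≡x′x″ (λ j → trans (sym (x≡x′x″ j)) (x≡x″x′ j)) i (p ^ⁿ a))
          (cong (λ z → fold z (x′ ⟨$⟩ʳ_) (p ^ⁿ a)) (trans (sym (^-fold x″ (p ^ⁿ a) i)) (HasOrder.power order″ i)))

      -- The exponents j for which the j-th power of `x′` preserves f are the multiples of some g.
      -- Among them are the order k of `x′` and, since x and `x′` have the same p^a-th power, also
      -- p^a. As k is prime to p, g = 1.
      preserved-regularPart : ∀ {f : Fin n → C} → f PreservedBy x → f PreservedBy x′
      preserved-regularPart {f} pres = conclude (generator T?
          (λ {b} {c} Tb Tc i → trans (cong f (fold-+ i (x′ ⟨$⟩ʳ_) b {c})) (trans (Tb _) (Tc i)))
          (λ {b} {c} Tb Tbc i → trans (sym (trans (cong f (fold-+ i (x′ ⟨$⟩ʳ_) b {c})) (Tb _))) (Tbc i))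
          (>-nonZero⁻¹ k {{HasOrder.positive order′}}) Tk)
        where
        T : ℕ → Set
        T j = ∀ i → f (fold i (x′ ⟨$⟩ʳ_) j) ≡ f i
        T? : Decidable T
        T? j = Fin.all? λ i → f (fold i (x′ ⟨$⟩ʳ_) j) ≟ f i
        Tk : T k
        Tk i = cong f (trans (sym (^-fold x′ k i)) (HasOrder.power order′ i))
        Tp^a : T (p ^ⁿ a)
        Tp^a i = trans (cong f (sym (power-p^a i))) (fold-preserved pres i (p ^ⁿ a))
        conclude : (∃ λ g → 0 < g × (∀ j → T j ⇔ g ∣ j)) → f PreservedBy x′
        conclude (g , _ , T⇔) with ∣p^a⇒≡1⊎p∣ pr a (to (T⇔ _) Tp^a)
        ... | inj₁ refl = from (T⇔ 1) ∣-refl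
        ... | inj₂ p∣g  = ⊥-elim (>⇒≢ (nonTrivial⇒n>1 p {{prime⇒nonTrivial pr}})
                           (k-coprime (∣-trans p∣g (to (T⇔ k) Tk) , ∣-refl)))

      -- x acts on the fixed points of x′ with p-power order.
      fixedColourings-regularPart : ∀ κ → let open Colourings _≟_ κ in
        _~_ p (length (fixedColourings x)) (length (fixedColourings x′))
      fixedColourings-regularPart κ = ~-trans
        (≡⇒~ (↭-length (unique∧set⇒↭ (fixedColourings-! x) (Unique.filter⁺ (fixed? x) (fixedColourings-! x′)) (mk⇔ fwd bwd))))
        (~-sym (fixedPoints (act-injective x) pr _≟ᵛ_ a (fixedColourings-! x′) closed torsion))
        where
        open Colourings _≟_ κ
        fwd : ∀ {v} → v ∈ fixedColourings x → v ∈ filter (fixed? x) (fixedColourings x′)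
        fwd v∈ with v∈′ , pres ← to (∈-fixedColourings x) v∈ = ∈-filter⁺ (fixed? x)
          (from (∈-fixedColourings x′) (v∈′ , preserved-regularPart pres)) (from (act-fixed x) pres)
        bwd : ∀ {v} → v ∈ filter (fixed? x) (fixedColourings x′) → v ∈ fixedColourings x
        bwd v∈ with v∈′ , fix ← ∈-filter⁻ (fixed? x) {xs = fixedColourings x′} v∈ =
          from (∈-fixedColourings x) (proj₁ (to (∈-fixedColourings x′) v∈′) , to (act-fixed x) fix)
        closed : ∀ {v} → v ∈ fixedColourings x′ → act x v ∈ fixedColourings x′
        closed {v} v∈ with v∈′ , pres ← to (∈-fixedColourings x′) v∈ =
          from (∈-fixedColourings x′) (act-colourings x v∈′ , λ i → trans (lookup-act x v _)
            (trans (cong (lookup v) (trans (x≡x′x″ _) (cong (x′ ⟨$⟩ʳ_) (sym (x≡x″x′ i)))))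
              (trans (pres _) (sym (lookup-act x v i)))))
        torsion : ∀ {v} → v ∈ fixedColourings x′ → fold v (act x) (p ^ⁿ a) ≡ v
        torsion {v} v∈ = lookup-ext λ i → trans (lookup-fold-act x v (p ^ⁿ a) i)
          (trans (cong (lookup v) (power-p^a i)) (fold-preserved (proj₂ (to (∈-fixedColourings x′) v∈)) i (p ^ⁿ a)))

    conjugateRegularParts⇒~ : ∀ {x y} → ConjugateRegularParts p x y → ∀ κ → let open Colourings _≟_ κ in
      _~_ p (length (fixedColourings x)) (length (fixedColourings y))
    conjugateRegularParts⇒~ {x} {y} (x′ , y′ , regx , regy , conj) κ =
      ~-trans (fixedColourings-regularPart {x} {x′} regx κ)
        (~-trans (≡⇒~ (Colourings.conjugate-fixedColourings _≟_ κ {x′} {y′} conj)) (~-sym (fixedColourings-regularPart {y} {y′} regy κ)))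

module _ {m : ℕ} where
  open Group (symmetricGroup (suc m)) using (_∙_; _⁻¹)
  open GroupTheory (symmetricGroup (suc m))

  -- `Parabolic J` is the stabiliser of κ. Leaving κ open admits, besides block numbers, two colours
  -- for maximal parabolic subgroups and colourings transported to a conjugate subset.
  Detects : Subset m → (Fin (suc m) → C) → Set
  Detects J κ = ∀ π → Parabolic J π ⇔ κ PreservedBy π

  block-detects : ∀ J → Detects J (block J)
  block-detects J π = mk⇔ (parabolic-preserves (block-constant J)) preserves⇒parabolic

  β≡fixedColourings : (_≟_ : DecidableEquality C) → ∀ {J K : Subset m} {κ : Fin (suc m) → C} {c} →
    Detects J κ → IsCoxeterElement K c → β J K ≡ length (Colourings.fixedColourings _≟_ κ c)
  β≡fixedColourings _≟_ {J} {K} {κ} {c} det cox =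
    length-deduplicate-filter _ _ colouring coset (permutations (suc m)) (fixedColourings-! c) fwd bwd
    where
    open Colourings _≟_ κ
    coset : ∀ x y → SameLeftCoset (Parabolic J) x y ⇔ colouring x ≡ colouring y
    coset x y = mk⇔
      (λ h → tabulate-cong λ i →
        sym (trans (sym (to (det (x ⁻¹ ∙ y)) h (y ⟨$⟩ˡ i))) (cong (λ z → κ (x ⟨$⟩ˡ z)) (Perm.inverseʳ y))))
      (λ e → from (det (x ⁻¹ ∙ y)) λ i → begin
        κ (x ⟨$⟩ˡ (y ⟨$⟩ʳ i))           ≡⟨ lookup-colouring x (y ⟨$⟩ʳ i) ⟨
        lookup (colouring x) (y ⟨$⟩ʳ i)  ≡⟨ cong (λ v → lookup v (y ⟨$⟩ʳ i)) e ⟩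
        lookup (colouring y) (y ⟨$⟩ʳ i)  ≡⟨ lookup-colouring y (y ⟨$⟩ʳ i) ⟩
        κ (y ⟨$⟩ˡ (y ⟨$⟩ʳ i))           ≡⟨ cong κ (Perm.inverseˡ y) ⟩
        κ i                              ∎)
      where open ≡-Reasoning

    fixes⇒ : ∀ g → FixesCoset (Parabolic K) (Parabolic J) g → lookup (colouring g) PreservedBy c
    fixes⇒ g h = from (coxeter-preserves⇔constant _≟_ {c = c} cox {lookup (colouring g)}) λ i i∈ → begin
      lookup (colouring g) (inject₁ i)
        ≡⟨ lookup-colouring g (inject₁ i) ⟩
      κ (g ⟨$⟩ˡ inject₁ i)
        ≡⟨ cong (λ z → κ (g ⟨$⟩ˡ z)) (trans (cong (s i ⟨$⟩ˡ_) (Perm.inverseʳ g))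
             (trans (cong (s i ⟨$⟩ˡ_) (sym (s-left i))) (Perm.inverseˡ (s i)))) ⟨
      κ (g ⟨$⟩ˡ (s i ⟨$⟩ˡ (g ⟨$⟩ʳ (g ⟨$⟩ˡ suc i))))
        ≡⟨ to (det ((s i ∙ g) ⁻¹ ∙ g)) (h (s i) (gen (i , i∈ , λ _ → refl))) (g ⟨$⟩ˡ suc i) ⟩
      κ (g ⟨$⟩ˡ suc i)
        ≡⟨ lookup-colouring g (suc i) ⟨
      lookup (colouring g) (suc i) ∎
      where open ≡-Reasoning

    ⇒fixes : ∀ g → lookup (colouring g) PreservedBy c → FixesCoset (Parabolic K) (Parabolic J) g
    ⇒fixes g pres k k∈ = from (det ((k ∙ g) ⁻¹ ∙ g)) λ i → begin
      κ (g ⟨$⟩ˡ (k ⟨$⟩ˡ (g ⟨$⟩ʳ i)))           ≡⟨ lookup-colouring g (k ⟨$⟩ˡ (g ⟨$⟩ʳ i)) ⟨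
      lookup (colouring g) (k ⟨$⟩ˡ (g ⟨$⟩ʳ i))  ≡⟨ parabolic-preserves {f = lookup (colouring g)} {k ⁻¹}
                                                   (to (coxeter-preserves⇔constant _≟_ {c = c} cox) pres) (inv k∈) (g ⟨$⟩ʳ i) ⟩
      lookup (colouring g) (g ⟨$⟩ʳ i)           ≡⟨ lookup-colouring g (g ⟨$⟩ʳ i) ⟩
      κ (g ⟨$⟩ˡ (g ⟨$⟩ʳ i))                    ≡⟨ cong κ (Perm.inverseˡ g) ⟩
      κ i                                       ∎
      where open ≡-Reasoning

    fwd : ∀ {v} → v ∈ fixedColourings c →
      ∃ λ g → g ∈ permutations (suc m) × FixesCoset (Parabolic K) (Parabolic J) g × v ≡ colouring g
    fwd {v} v∈ =
      let v∈′ , pres = to (∈-fixedColourings c) v∈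
          h , v≡h = to ∈-colourings v∈′
          h′ , h′∈ , e = ∈-permutations h
          v≡h′ = trans v≡h (colouring-cong {h} {h′} e)
      in h′ , h′∈ , ⇒fixes h′ (subst (λ v → lookup v PreservedBy c) v≡h′ pres) , v≡h′

    bwd : ∀ g → FixesCoset (Parabolic K) (Parabolic J) g → colouring g ∈ fixedColourings c
    bwd g fix = from (∈-fixedColourings c) (from ∈-colourings (g , refl) , fixes⇒ g fix)

module _ (_≟_ : DecidableEquality C) where

  countFin : (Fin n → C) → C → ℕ
  countFin {n} P = countLabel _≟_ P (allFin n)

  indicator : C → C → ℕ
  indicator c c′ = if does (c ≟ c′) then 1 else 0

  countLabel-sum : ∀ (P : A → C) us c → countLabel _≟_ P us c ≡ sum (map (λ u → indicator c (P u)) us)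
  countLabel-sum P []       c = refl
  countLabel-sum P (u ∷ us) c with does (c ≟ P u)
  ... | true  = cong suc (countLabel-sum P us c)
  ... | false = countLabel-sum P us c

  countFin-suc : ∀ (P : Fin (suc n) → C) c → countFin P c ≡ indicator c (P zero) + countFin (P ∘ suc) c
  countFin-suc {n} P c = trans (first (P zero) refl) (cong (indicator c (P zero) +_) rest)
    where
    first : ∀ c′ → P zero ≡ c′ → countFin P c ≡ indicator c c′ + countLabel _≟_ P (List.tabulate suc) c
    first c′ refl with does (c ≟ P zero)
    ... | true  = refl
    ... | false = refl
    rest : countLabel _≟_ P (List.tabulate suc) c ≡ countFin (P ∘ suc) c
    rest = trans (cong (λ us → countLabel _≟_ P us c) (sym (map-tabulate id suc)))
      (trans (countLabel-map _≟_ {P = P} {P ∘ suc} {suc} {id} (λ _ → refl) (allFin n) c)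
        (cong (λ us → countLabel _≟_ (P ∘ suc) us c) (map-tabulate id id)))

  countFin-permute : ∀ (P : Fin n → C) (π : Permutation′ n) c → countFin (P ∘ (π ⟨$⟩ʳ_)) c ≡ countFin P c
  countFin-permute {n} P π c = trans
    (sym (trans (countLabel-map _≟_ {P = P} {P ∘ (π ⟨$⟩ʳ_)} {π ⟨$⟩ʳ_} {id} (λ _ → refl) (allFin n) c)
      (cong (λ us → countLabel _≟_ (P ∘ (π ⟨$⟩ʳ_)) us c) (map-tabulate id id))))
    (countLabel-↭ _≟_ P (unique∧set⇒↭ (Unique.map⁺ (perm-injective π) (Unique.allFin⁺ n)) (Unique.allFin⁺ n)
      (mk⇔ (λ _ → ∈-allFin _) (λ _ → image _))) c)
    where
    image : ∀ i → i ∈ map (π ⟨$⟩ʳ_) (allFin n)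
    image i = subst (_∈ map (π ⟨$⟩ʳ_) (allFin n)) (Perm.inverseʳ π) (∈-map⁺ (π ⟨$⟩ʳ_) (∈-allFin (π ⟨$⟩ˡ i)))

trues : (Fin n → Bool) → ℕ
trues f = countFin Bool._≟_ f true

countFin-true+false : ∀ {n} (f : Fin n → Bool) → countFin Bool._≟_ f true + countFin Bool._≟_ f false ≡ n
countFin-true+false {n} f = trans (go (allFin n)) (length-tabulate id)
  where
  go : ∀ us → countLabel Bool._≟_ f us true + countLabel Bool._≟_ f us false ≡ length us
  go [] = refl
  go (u ∷ us) with f u
  ... | true  = cong suc (go us)
  ... | false = trans (+-suc _ _) (cong suc (go us))

-- The symmetric group is transitive on the sets of a given size. The required permutation is an
-- `intertwiner` of identity maps, for which every point is an orbit of length 1.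
∈-colourings-Bool : ∀ {κ : Fin n → Bool} {v} → v ∈ Colourings.colourings Bool._≟_ κ ⇔ trues (lookup v) ≡ trues κ
∈-colourings-Bool {n} {κ} {v} = mk⇔ fwd bwd
  where
  open Colourings Bool._≟_ κ
  fwd : v ∈ colourings → trues (lookup v) ≡ trues κ
  fwd v∈ with h , refl ← to ∈-colourings v∈ = begin
    trues (lookup (colouring h))    ≡⟨ countFin-permute Bool._≟_ _ h true ⟨
    trues (λ i → lookup (colouring h) (h ⟨$⟩ʳ i))
      ≡⟨ cong-trues (λ i → trans (lookup-colouring h (h ⟨$⟩ʳ i)) (cong κ (Perm.inverseˡ h))) ⟩
    trues κ                         ∎
    where
    open ≡-Reasoning
    cong-trues : ∀ {f g : Fin n → Bool} → (∀ i → f i ≡ g i) → trues f ≡ trues g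
    cong-trues {f} {g} e = subst₂ (λ us vs → countLabel Bool._≟_ f us true ≡ countLabel Bool._≟_ g vs true)
      (map-tabulate id id) (map-tabulate id id) (countLabel-map Bool._≟_ {P = f} {g} {id} {id} e (allFin n) true)
  bwd : trues (lookup v) ≡ trues κ → v ∈ colourings
  bwd e = from ∈-colourings (proj₁ h , lookup-ext λ i → trans (sym (move i)) (sym (lookup-colouring (proj₁ h) i)))
    where
    counts : ∀ c → countFin Bool._≟_ κ c ≡ countFin Bool._≟_ (lookup v) c
    counts true  = sym e
    counts false = +-cancelˡ-≡ (trues κ) _ _ (trans (countFin-true+false κ)
      (sym (trans (cong (_+ countFin Bool._≟_ (lookup v) false) (sym e)) (countFin-true+false (lookup v)))))
    trivial : ∀ {i : Fin n} → IsPeriod id i 1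
    trivial j = mk⇔ (λ _ → 1∣ j) (λ _ → fold-id j)
      where
      fold-id : ∀ {i : Fin n} j → fold i id j ≡ i
      fold-id zero    = refl
      fold-id (suc j) = fold-id j
    h = intertwiner Bool._≟_ id id κ (lookup v) (λ _ → refl) (λ _ → refl) (λ _ → 1) (λ _ → z<s)
          (λ _ → trivial) (λ _ → trivial) counts
    move : ∀ i → κ (proj₁ h ⟨$⟩ˡ i) ≡ lookup v i
    move i = trans (sym (proj₂ (proj₂ h) _)) (cong (lookup v) (Perm.inverseʳ (proj₁ h)))

-- Columns of the table of marks on maximal parabolic subgroups

-- The maximal parabolic subgroup of type S_(j+1) × S_(m-j), with j counted from 0.
allBut : Fin m → Subset m
allBut {suc m} zero    = false ∷ Vec.replicate m true
allBut {suc m} (suc j) = true ∷ allBut j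

initial : Fin m → Fin (suc m) → Bool
initial j       zero    = true
initial zero    (suc i) = false
initial (suc j) (suc i) = initial j i

block-allBut : ∀ (j : Fin m) i → block (allBut j) i ≡ (if initial j i then 0 else 1)
block-allBut zero    zero    = refl
block-allBut (suc j) zero    = refl
block-allBut {suc m} zero    (suc i) = cong suc (full m i)
  where
  full : ∀ m (i : Fin (suc m)) → block (Vec.replicate m true) i ≡ 0
  full m       zero    = refl
  full (suc m) (suc i) = full m i
block-allBut (suc j) (suc i) = block-allBut j i

trues-initial : ∀ (j : Fin m) → trues (initial j) ≡ suc (toℕ j)
trues-initial {suc m} zero    = trans (countFin-suc Bool._≟_ (initial {suc m} zero) true) (cong suc (none m))
  where
  none : ∀ m → countFin Bool._≟_ {suc m} (λ _ → false) true ≡ 0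
  none m = trans (countLabel-sum Bool._≟_ (λ _ → false) (allFin (suc m)) true) (zeros (allFin (suc m)))
    where
    zeros : ∀ {n} (is : List (Fin n)) → sum (map (λ _ → 0) is) ≡ 0
    zeros []       = refl
    zeros (_ ∷ is) = zeros is
trues-initial (suc j) = trans (countFin-suc Bool._≟_ (initial (suc j)) true) (cong suc (trues-initial j))

module _ {m : ℕ} where
  open Group (symmetricGroup (suc m)) using (_∙_; ε; _⁻¹)
  open GroupTheory (symmetricGroup (suc m))

  initial-detects : ∀ (j : Fin m) → Detects (allBut j) (initial j)
  initial-detects j π = mk⇔
    (λ q i → decode (trans (sym (block-allBut j (π ⟨$⟩ʳ i))) (trans (to (block-detects (allBut j) π) q i) (block-allBut j i))))
    (λ pres → from (block-detects (allBut j) π) λ i →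
      trans (block-allBut j (π ⟨$⟩ʳ i)) (trans (cong (if_then 0 else 1) (pres i)) (sym (block-allBut j i))))
    where
    decode : ∀ {b c} → (if b then 0 else 1) ≡ (if c then 0 else 1) → b ≡ c
    decode {true}  {true}  _ = refl
    decode {false} {false} _ = refl

  conjugate-generated : ∀ {X Y} g → (∀ {x} → X x → ⟨ Y ⟩ (g ∙ x ∙ g ⁻¹)) → ∀ {x} → ⟨ X ⟩ x → ⟨ Y ⟩ (g ∙ x ∙ g ⁻¹)
  conjugate-generated {X} {Y} g h = go
    where
    go : ∀ {x} → ⟨ X ⟩ x → ⟨ Y ⟩ (g ∙ x ∙ g ⁻¹)
    go (gen Xx) = h Xx
    go one      = resp {x = ε} (λ i → sym (Perm.inverseʳ g)) one
    go (mul {x} {y} p q) = resp {x = (g ∙ x ∙ g ⁻¹) ∙ (g ∙ y ∙ g ⁻¹)}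
      (λ i → cong (λ z → g ⟨$⟩ʳ (x ⟨$⟩ʳ z)) (Perm.inverseˡ g)) (mul (go p) (go q))
    go (inv {x} p) = resp {x = (g ∙ x ∙ g ⁻¹) ⁻¹} (λ i → refl) (inv (go p))
    go (resp {x} {y} e p) = resp {x = g ∙ x ∙ g ⁻¹} (λ i → cong (g ⟨$⟩ʳ_) (e _)) (go p)

  -- Conjugating a stabiliser by g amounts to transporting the colouring along g. This moves the
  -- two-colouring of `allBut j` to the representative of its class in E.
  conjugate-detects : ∀ {J J′ : Subset m} {κ : Fin (suc m) → C} → Detects J κ → ((g , _) : ConjugateSubsets J J′) →
    Detects J′ (κ ∘ (g ⟨$⟩ˡ_))
  conjugate-detects {J = J} {J′} {κ} det (g , e) π = mk⇔
    (λ q i → trans (cong (λ z → κ (g ⟨$⟩ˡ (π ⟨$⟩ʳ z))) (sym (Perm.inverseʳ g)))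
      (to (det (g ⁻¹ ∙ π ∙ g)) (conjugate-generated (g ⁻¹) (λ {x} → back x) q) (g ⟨$⟩ˡ i)))
    (λ pres → resp {x = g ∙ (g ⁻¹ ∙ π ∙ g) ∙ g ⁻¹} (λ i → trans (Perm.inverseʳ g) (cong (π ⟨$⟩ʳ_) (Perm.inverseʳ g)))
      (conjugate-generated g (λ {x} Jx → gen (to (e x) Jx))
        (from (det (g ⁻¹ ∙ π ∙ g)) λ i → trans (pres (g ⟨$⟩ʳ i)) (cong κ (Perm.inverseˡ g)))))
    where
    back : ∀ x → simpleReflections J′ x → Parabolic J (g ⁻¹ ∙ x ∙ g)
    back x (i , i∈ , x≈) = gen (from (e (g ⁻¹ ∙ x ∙ g)) (i , i∈ , λ k →
      trans (trans (Perm.inverseʳ g) (cong (x ⟨$⟩ʳ_) (Perm.inverseʳ g))) (x≈ k)))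

-- Block sizes and the generating function of unions of blocks

firstBlock : Subset m → ℕ
firstBlock []          = 1
firstBlock (true ∷ K)  = suc (firstBlock K)
firstBlock (false ∷ K) = 1

otherBlocks : Subset m → List ℕ
otherBlocks []          = []
otherBlocks (true ∷ K)  = otherBlocks K
otherBlocks (false ∷ K) = firstBlock K ∷ otherBlocks K

blockSizes : Subset m → List ℕ
blockSizes K = firstBlock K ∷ otherBlocks K

firstBlock>0 : (K : Subset m) → 0 < firstBlock K
firstBlock>0 []          = z<s
firstBlock>0 (true ∷ K)  = z<s
firstBlock>0 (false ∷ K) = z<s

blockSizes>0 : (K : Subset m) → All (0 <_) (blockSizes K)
blockSizes>0 K = firstBlock>0 K ∷ others K
  where
  others : ∀ {m} (K : Subset m) → All (0 <_) (otherBlocks K)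
  others []          = []
  others (true ∷ K)  = others K
  others (false ∷ K) = firstBlock>0 K ∷ others K

sum-blockSizes : (K : Subset m) → sum (blockSizes K) ≡ suc m
sum-blockSizes []          = refl
sum-blockSizes (true ∷ K)  = cong suc (sum-blockSizes K)
sum-blockSizes (false ∷ K) = cong suc (sum-blockSizes K)

-- The unions of blocks that contain the first point iff the flag is set.
unions : Bool → Subset m → List (Vec Bool (suc m))
unions v []          = [ v ∷ [] ]
unions v (true ∷ K)  = map (v ∷_) (unions v K)
unions v (false ∷ K) = map (v ∷_) (unions true K ++ unions false K)

allUnions : Subset m → List (Vec Bool (suc m))
allUnions K = unions true K ++ unions false K

unions-head : ∀ v (K : Subset m) {w} → w ∈ unions v K → lookup w zero ≡ v
unions-head v []          (here refl) = refl
unions-head v (true ∷ K)  w∈ with _ , _ , refl ← ∈-map⁻ (v ∷_) w∈ = refl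
unions-head v (false ∷ K) w∈ with _ , _ , refl ← ∈-map⁻ (v ∷_) w∈ = refl

unions-! : ∀ v (K : Subset m) → Unique (unions v K)
allUnions-! : (K : Subset m) → Unique (allUnions K)
unions-! v []          = [] ∷ []
unions-! v (true ∷ K)  = Unique.map⁺ (λ { refl → refl }) (unions-! v K)
unions-! v (false ∷ K) = Unique.map⁺ (λ { refl → refl }) (allUnions-! K)
allUnions-! K = Unique.++⁺ (unions-! true K) (unions-! false K)
  λ (t , f) → contradiction (trans (sym (unions-head true K t)) (unions-head false K f)) λ ()

∈-unions : ∀ v (K : Subset m) {w} → w ∈ unions v K ⇔ (lookup w zero ≡ v × lookup w ConstantOn K)
∈-allUnions : (K : Subset m) → ∀ {w} → w ∈ allUnions K ⇔ lookup w ConstantOn K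
∈-unions v K = mk⇔ (λ w∈ → unions-head v K w∈ , fwd v K w∈) (λ (e , cst) → bwd v K e cst)
  where
  fwd : ∀ {m} v (K : Subset m) {w} → w ∈ unions v K → lookup w ConstantOn K
  fwd v (true ∷ K) w∈ i i∈ with u , u∈ , refl ← ∈-map⁻ (v ∷_) w∈ with i | i∈
  ... | zero  | here      = sym (unions-head v K u∈)
  ... | suc j | there j∈ = fwd v K u∈ j j∈
  fwd v (false ∷ K) w∈ (suc j) (there j∈) with u , u∈ , refl ← ∈-map⁻ (v ∷_) w∈ = to (∈-allUnions K) u∈ j j∈
  bwd : ∀ {m} v (K : Subset m) {w} → lookup w zero ≡ v → lookup w ConstantOn K → w ∈ unions v K
  bwd v []          {_ ∷ []} refl cst = here refl
  bwd v (true ∷ K)  {_ ∷ w}  refl cst = ∈-map⁺ (v ∷_) (bwd v K (sym (cst zero here)) (λ i i∈ → cst (suc i) (there i∈)))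
  bwd v (false ∷ K) {_ ∷ w}  refl cst = ∈-map⁺ (v ∷_) (from (∈-allUnions K) (λ i i∈ → cst (suc i) (there i∈)))
∈-allUnions K {w} = mk⇔
  (λ w∈ → [ (λ t → proj₂ (to (∈-unions true K) t)) , (λ f → proj₂ (to (∈-unions false K) f)) ]′ (∈-++⁻ (unions true K) w∈))
  (λ cst → pick (lookup w zero) refl cst)
  where
  pick : ∀ v → lookup w zero ≡ v → lookup w ConstantOn K → w ∈ allUnions K
  pick true  e cst = ∈-++⁺ˡ (from (∈-unions true K) (e , cst))
  pick false e cst = ∈-++⁺ʳ (unions true K) (from (∈-unions false K) (e , cst))

truesᵛ : Vec Bool n → ℕ
truesᵛ []          = 0
truesᵛ (true ∷ w)  = suc (truesᵛ w)
truesᵛ (false ∷ w) = truesᵛ w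

trues-lookup : (w : Vec Bool n) → trues (lookup w) ≡ truesᵛ w
trues-lookup []          = refl
trues-lookup (true ∷ w)  = trans (countFin-suc Bool._≟_ (lookup (true ∷ w)) true) (cong suc (trues-lookup w))
trues-lookup (false ∷ w) = trans (countFin-suc Bool._≟_ (lookup (false ∷ w)) true) (trues-lookup w)

countUnions : Bool → Subset m → ℕ → ℕ
countUnions v K = countLabel _≟_ truesᵛ (unions v K)

private
  count-cons : ∀ (ws : List (Vec Bool n)) b → countLabel _≟_ truesᵛ (map (true ∷_) ws) b ≡ shift 1 (countLabel _≟_ truesᵛ ws) b
  count-cons []       zero    = refl
  count-cons []       (suc b) = refl
  count-cons (w ∷ ws) zero    = count-cons ws zero
  count-cons (w ∷ ws) (suc b) with does (b ≟ truesᵛ w)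
  ... | true  = cong suc (count-cons ws (suc b))
  ... | false = count-cons ws (suc b)

  count-cons′ : ∀ (ws : List (Vec Bool n)) b → countLabel _≟_ truesᵛ (map (false ∷_) ws) b ≡ countLabel _≟_ truesᵛ ws b
  count-cons′ []       b = refl
  count-cons′ (w ∷ ws) b with does (b ≟ truesᵛ w)
  ... | true  = cong suc (count-cons′ ws b)
  ... | false = count-cons′ ws b

-- If the first block has size a, taking it contributes t^a and leaving it out contributes 1;
-- together these are the first factor 1 + t^a of the product.
countUnions-true : (K : Subset m) → ∀ b → countUnions true K b ≡ shift (firstBlock K) (subsums (otherBlocks K)) b
countUnions-false : (K : Subset m) → ∀ b → countUnions false K b ≡ subsums (otherBlocks K) b
countAllUnions : (K : Subset m) → ∀ b → countLabel _≟_ truesᵛ (allUnions K) b ≡ subsums (blockSizes K) b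
countUnions-true [] zero          = refl
countUnions-true [] (suc zero)    = refl
countUnions-true [] (suc (suc b)) = refl
countUnions-true (true ∷ K) b = trans (count-cons (unions true K) b)
  (trans (shift-cong 1 (countUnions-true K) b) (shift-shift 1 (firstBlock K) (subsums (otherBlocks K)) b))
countUnions-true (false ∷ K) b = trans (count-cons (allUnions K) b) (shift-cong 1 (countAllUnions K) b)
countUnions-false [] zero    = refl
countUnions-false [] (suc b) = refl
countUnions-false (true ∷ K)  b = trans (count-cons′ (unions false K) b) (countUnions-false K b)
countUnions-false (false ∷ K) b = trans (count-cons′ (allUnions K) b) (countAllUnions K b)
countAllUnions K b = trans (countLabel-++ _≟_ truesᵛ (unions true K) (unions false K) b)
  (trans (cong₂ _+_ (countUnions-true K b) (countUnions-false K b)) (+-comm (shift (firstBlock K) (subsums (otherBlocks K)) b) _))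

fixedColourings-Bool : ∀ {K : Subset m} {c} → IsCoxeterElement K c → ∀ κ →
  length (Colourings.fixedColourings Bool._≟_ κ c) ≡ subsums (blockSizes K) (trues κ)
fixedColourings-Bool {K = K} {c} cox κ = trans
  (↭-length (unique∧set⇒↭ (fixedColourings-! c) (Unique.filter⁺ size? (allUnions-! K)) (mk⇔ fwd bwd)))
  (countAllUnions K (trues κ))
  where
  open Colourings Bool._≟_ κ
  size? : Decidable (λ w → trues κ ≡ truesᵛ w)
  size? w = trues κ ≟ truesᵛ w
  const⇔ : ∀ {f} → f PreservedBy c ⇔ f ConstantOn K
  const⇔ = coxeter-preserves⇔constant Bool._≟_ {c = c} cox
  fwd : ∀ {w} → w ∈ fixedColourings c → w ∈ filter size? (allUnions K)
  fwd {w} w∈ = let w∈′ , pres = to (∈-fixedColourings c) w∈ in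
    ∈-filter⁺ size? (from (∈-allUnions K) (to const⇔ pres)) (trans (sym (to (∈-colourings-Bool {κ = κ}) w∈′)) (trues-lookup w))
  bwd : ∀ {w} → w ∈ filter size? (allUnions K) → w ∈ fixedColourings c
  bwd {w} w∈ = let w∈′ , e = ∈-filter⁻ size? {xs = allUnions K} w∈ in
    from (∈-fixedColourings c) (from (∈-colourings-Bool {κ = κ}) (trans (trues-lookup w) (sym e)) , from const⇔ (to (∈-allUnions K) w∈′))

-- The default 0 is the number of points in a block that does not exist, so `countFin-block` holds
-- for every k.
at : List ℕ → ℕ → ℕ
at []       _       = 0
at (a ∷ as) zero    = a
at (a ∷ as) (suc k) = at as k

blockSize : Subset m → Fin (suc m) → ℕ
blockSize K i = at (blockSizes K) (block K i)

countFin-block : (K : Subset m) → ∀ k → countFin _≟_ (block K) k ≡ at (blockSizes K) k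
countFin-block {zero}  [] zero    = refl
countFin-block {zero}  [] (suc k) = refl
countFin-block {suc m} (true ∷ K) zero =
  trans (countFin-suc _≟_ (block (true ∷ K)) 0) (cong suc (countFin-block K 0))
countFin-block {suc m} (true ∷ K) (suc k) =
  trans (countFin-suc _≟_ (block (true ∷ K)) (suc k)) (countFin-block K (suc k))
countFin-block {suc m} (false ∷ K) zero =
  trans (countFin-suc _≟_ (block (false ∷ K)) 0) (cong suc (none (allFin (suc m))))
  where
  none : ∀ is → countLabel _≟_ (suc ∘ block K) is 0 ≡ 0
  none []       = refl
  none (_ ∷ is) = none is
countFin-block {suc m} (false ∷ K) (suc k) =
  trans (countFin-suc _≟_ (block (false ∷ K)) (suc k)) (trans (pred-label (allFin (suc m))) (countFin-block K k))
  where
  pred-label : ∀ is → countLabel _≟_ (suc ∘ block K) is (suc k) ≡ countLabel _≟_ (block K) is k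
  pred-label []       = refl
  pred-label (i ∷ is) with does (k ≟ block K i)
  ... | true  = cong suc (pred-label is)
  ... | false = pred-label is

private
  -- Blocks are intervals, so reading a function of the block number from left to right repeats its
  -- k-th value as often as block k has points.
  expand : (ℕ → ℕ) → List ℕ → List ℕ
  expand ψ []       = []
  expand ψ (a ∷ as) = replicate a (ψ 0) ++ expand (ψ ∘ suc) as

  map-block : (K : Subset m) → ∀ ψ → map (ψ ∘ block K) (allFin (suc m)) ≡ expand ψ (blockSizes K)
  map-block {zero}  []          ψ = refl
  map-block {suc m} (true ∷ K)  ψ = cong (ψ 0 ∷_) (trans (trans (map-tabulate suc (ψ ∘ block (true ∷ K)))
    (sym (map-tabulate id (ψ ∘ block K)))) (map-block K ψ))
  map-block {suc m} (false ∷ K) ψ = cong (ψ 0 ∷_) (trans (trans (map-tabulate suc (ψ ∘ block (false ∷ K)))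
    (sym (map-tabulate id (ψ ∘ suc ∘ block K)))) (map-block K (ψ ∘ suc)))

  sum-expand : ∀ φ as → sum (expand (φ ∘ at as) as) ≡ weight φ as
  sum-expand φ []       = refl
  sum-expand φ (a ∷ as) = trans (sum-++ (replicate a (φ a)) (expand (φ ∘ at as) as))
    (cong₂ _+_ (sum-replicate a) (sum-expand φ as))
    where
    sum-replicate : ∀ {x} k → sum (replicate k x) ≡ k * x
    sum-replicate zero        = refl
    sum-replicate {x} (suc k) = cong (x +_) (sum-replicate k)

-- Expresses a count of labelled points as a `weight`, the quantity that the generating function
-- modulo p can determine.
countFin-blockSize : (K : Subset m) → ∀ ρ c →
  countFin _≟_ (ρ ∘ blockSize K) c ≡ weight (λ a → indicator _≟_ c (ρ a)) (blockSizes K)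
countFin-blockSize {m} K ρ c = begin
  countFin _≟_ (ρ ∘ blockSize K) c
    ≡⟨ countLabel-sum _≟_ (ρ ∘ blockSize K) (allFin (suc m)) c ⟩
  sum (map (φ ∘ at (blockSizes K) ∘ block K) (allFin (suc m)))
    ≡⟨ cong sum (map-block K (φ ∘ at (blockSizes K))) ⟩
  sum (expand (φ ∘ at (blockSizes K)) (blockSizes K))
    ≡⟨ sum-expand φ (blockSizes K) ⟩
  weight φ (blockSizes K) ∎
  where
  open ≡-Reasoning
  φ : ℕ → ℕ
  φ a = indicator _≟_ c (ρ a)

-- Regular parts of Coxeter elements

-- The summands in `crt` are the exponents of the p-regular part and of the p-part of an element
-- whose N-th power is trivial: each is 1 modulo one of q and p^a and 0 modulo the other.
record PrimeSplitting (p N : ℕ) : Set where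
  field
    a q u v t : ℕ
    N≡  : N ≡ p ^ⁿ a * q
    p∤q : ¬ p ∣ q
    crt : p ^ⁿ a * u + q * v ≡ 1 + t * N

primePowerFactor : ∀ {p} → Prime p → ∀ N → 0 < N → ∃₂ λ a q → N ≡ p ^ⁿ a * q × ¬ p ∣ q
primePowerFactor {p} pr N N>0 = go N N ≤-refl N>0
  where
  go : ∀ l N → N ≤ l → 0 < N → ∃₂ λ a q → N ≡ p ^ⁿ a * q × ¬ p ∣ q
  go zero    (suc N) () N>0
  go (suc l) N le N>0 with p ∣? N
  ... | no p∤N = 0 , N , sym (+-identityʳ N) , p∤N
  ... | yes (divides zero    refl) with () ← N>0
  ... | yes (divides (suc M) refl) =
    let a , q , e , p∤q = go l (suc M) (s≤s⁻¹ (≤-trans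
          (subst (suc M <_) (*-comm p (suc M)) (m<n*m (suc M) p (nonTrivial⇒n>1 p {{prime⇒nonTrivial pr}}))) le)) z<s
    in suc a , q , trans (*-comm (suc M) p) (trans (cong (p *_) e) (sym (*-assoc p (p ^ⁿ a) q))) , p∤q
    where
    m<n*m : ∀ m n → 1 < n → .{{NonZero m}} → m < n * m
    m<n*m m n 1<n = subst (_< n * m) (*-identityˡ m) (*-monoˡ-< m 1<n)

primeSplitting : ∀ {p} → Prime p → ∀ N → 0 < N → PrimeSplitting p N
primeSplitting {p} pr N@(suc N-1) N>0 = build (coprime-Bézout coprime)
  where
  factor = primePowerFactor pr N N>0
  a = proj₁ factor
  q = proj₁ (proj₂ factor)
  N≡ : N ≡ p ^ⁿ a * q
  N≡ = proj₁ (proj₂ (proj₂ factor))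
  p∤q : ¬ p ∣ q
  p∤q = proj₂ (proj₂ (proj₂ factor))
  P = p ^ⁿ a
  coprime : Coprime P q
  coprime (d∣P , d∣q) with ∣p^a⇒≡1⊎p∣ pr a d∣P
  ... | inj₁ d≡1 = d≡1
  ... | inj₂ p∣d = ⊥-elim (p∤q (∣-trans p∣d d∣q))
  build : Bézout.Identity 1 P q → PrimeSplitting p N
  -- The Bézout coefficient -y is replaced by y (N - 1), congruent to it modulo N; the other case
  -- treats x in the same way.
  build (Bézout.+- x y eq) = record { a = a ; q = q ; u = x ; v = y * N-1 ; t = y * q ; N≡ = N≡ ; p∤q = p∤q ; crt = begin
    P * x + q * (y * N-1)            ≡⟨ cong (_+ q * (y * N-1)) (trans (*-comm P x) (sym eq)) ⟩
    1 + y * q + q * (y * N-1)        ≡⟨ lemma y q N-1 ⟩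
    1 + y * q * (1 + N-1)            ∎ }
    where
    open ≡-Reasoning
    lemma : ∀ y q n → 1 + y * q + q * (y * n) ≡ 1 + y * q * (1 + n)
    lemma = solve-∀
  build (Bézout.-+ x y eq) = record { a = a ; q = q ; u = x * N-1 ; v = y ; t = x * P ; N≡ = N≡ ; p∤q = p∤q ; crt = begin
    P * (x * N-1) + q * y            ≡⟨ cong (P * (x * N-1) +_) (trans (*-comm q y) (sym eq)) ⟩
    P * (x * N-1) + (1 + x * P)      ≡⟨ lemma x P N-1 ⟩
    1 + x * P * (1 + N-1)            ∎ }
    where
    open ≡-Reasoning
    lemma : ∀ x P n → P * (x * n) + (1 + x * P) ≡ 1 + x * P * (1 + n)
    lemma = solve-∀

module RegularExponent {p N} (pr : Prime p) (S : PrimeSplitting p N) where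
  open PrimeSplitting S

  private
    P = p ^ⁿ a

  e f : ℕ
  e = P * u
  f = q * v

  -- As q is the p′-part of N, this is the p′-part of every divisor ℓ of N.
  regularFactor : ℕ → ℕ
  regularFactor ℓ = gcd ℓ q

  -- A divisor of q is prime to p, so the factor p cannot enter the gcd. This is the invariance that
  -- `subsums-determine-weight` asks for.
  regularFactor-p* : ∀ ℓ → regularFactor (p * ℓ) ≡ regularFactor ℓ
  regularFactor-p* ℓ = ∣-antisym
    (gcd-greatest (coprime-divisor coprime (gcd[m,n]∣m (p * ℓ) q)) (gcd[m,n]∣n (p * ℓ) q))
    (gcd-greatest (∣n⇒∣m*n p (gcd[m,n]∣m ℓ q)) (gcd[m,n]∣n ℓ q))
    where
    coprime : Coprime (gcd (p * ℓ) q) p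
    coprime = prime∤⇒coprime pr λ p∣g → p∤q (∣-trans p∣g (gcd[m,n]∣n (p * ℓ) q))

  q∣N : q ∣ N
  q∣N = subst (q ∣_) (sym N≡) (n∣m*n P)

  -- Gives the cycle lengths of the e-th power. Forwards, g divides both j e and j f, whose sum is j
  -- modulo N, and g divides N. Backwards, ℓ divides gcd(P ℓ, P q) = P g, hence P j, hence j e.
  ∣*e⇔ : ∀ {ℓ} → ℓ ∣ N → ∀ j → ℓ ∣ j * e ⇔ regularFactor ℓ ∣ j
  ∣*e⇔ {ℓ} ℓ∣N j = mk⇔ fwd bwd
    where
    g = regularFactor ℓ
    fwd : ℓ ∣ j * e → g ∣ j
    fwd d = ∣m+n∣m⇒∣n (subst (g ∣_) (trans (sym (*-distribˡ-+ j e f)) (trans (cong (j *_) crt)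
        (trans (*-distribˡ-+ j 1 (t * N)) (trans (cong (_+ j * (t * N)) (*-identityʳ j)) (+-comm j _)))))
        (∣m∣n⇒∣m+n (∣-trans (gcd[m,n]∣m ℓ q) d) (∣n⇒∣m*n j (∣m⇒∣m*n v (gcd[m,n]∣n ℓ q)))))
      (∣n⇒∣m*n j (∣n⇒∣m*n t (∣-trans (gcd[m,n]∣n ℓ q) q∣N)))
    bwd : g ∣ j → ℓ ∣ j * e
    bwd d = ∣-trans (subst (ℓ ∣_) (sym (c*gcd[m,n]≡gcd[cm,cn] P ℓ q))
        (gcd-greatest (n∣m*n P) (subst (ℓ ∣_) N≡ ℓ∣N)))
      (∣-trans (*-monoʳ-∣ P d) (subst (P * j ∣_) (lemma P j u) (m∣m*n u)))
      where
      lemma : ∀ P j u → P * j * u ≡ j * (P * u)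
      lemma = solve-∀

module _ {n : ℕ} where
  open Group (symmetricGroup n) using (_≈_; _∙_)
  open GroupTheory (symmetricGroup n)

  order : ∀ (w : Permutation′ n) {N} → 0 < N → (∀ i → fold i (w ⟨$⟩ʳ_) N ≡ i) → ∃ λ k → HasOrder w k × k ∣ N
  order w {N} N>0 wN = conclude (generator T? (λ {b} {c} Tb Tc i → trans (fold-+ i (w ⟨$⟩ʳ_) b {c}) (trans (Tb _) (Tc i)))
    (λ {b} {c} Tb Tbc i → trans (sym (trans (fold-+ i (w ⟨$⟩ʳ_) b {c}) (Tb _))) (Tbc i)) N>0 wN)
    where
    T : ℕ → Set
    T j = ∀ i → fold i (w ⟨$⟩ʳ_) j ≡ i
    T? : Decidable T
    T? j = Fin.all? λ i → fold i (w ⟨$⟩ʳ_) j Fin.≟ i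
    conclude : (∃ λ k → 0 < k × (∀ j → T j ⇔ k ∣ j)) → ∃ λ k → HasOrder w k × k ∣ N
    conclude (k , k>0 , T⇔) = k , record
      { positive = >-nonZero k>0
      ; power    = λ i → trans (^-fold n w k i) (from (T⇔ k) ∣-refl i)
      ; minimal  = λ j j≢0 wj → ∣⇒≤ {{j≢0}} (to (T⇔ j) λ i → trans (sym (^-fold n w j i)) (wj i))
      } , to (T⇔ N) wN

  fold-^ : ∀ (x : Permutation′ n) e i j → fold i ((x ^ e) ⟨$⟩ʳ_) j ≡ fold i (x ⟨$⟩ʳ_) (j * e)
  fold-^ x e i zero    = refl
  fold-^ x e i (suc j) = trans (cong ((x ^ e) ⟨$⟩ʳ_) (fold-^ x e i j))
    (trans (^-fold n x e _) (sym (fold-+ i (x ⟨$⟩ʳ_) e {j * e})))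

  module _ {p N} (pr : Prime p) (S : PrimeSplitting p N) where
    open PrimeSplitting S
    open RegularExponent pr S

    -- Both q e and p^a f are multiples of N, so the order of `x ^ e` divides q and that of `x ^ f`
    -- divides p^a; since e + f is 1 modulo N, the two powers multiply to x in either order.
    ^e-isRegularPart : ∀ (x : Permutation′ n) → 0 < N → (∀ i k → N ∣ k → fold i (x ⟨$⟩ʳ_) k ≡ i) → IsRegularPart p x (x ^ e)
    ^e-isRegularPart x N>0 xN = x ^ f , product e f crt , product f e (trans (+-comm f e) crt) , regular , torsion
      where
      instance _ = prime⇒nonZero pr
      product : ∀ g h → g + h ≡ 1 + t * N → x ≈ (x ^ g) ∙ (x ^ h)
      product g h eq i = sym (begin
        (x ^ g) ⟨$⟩ʳ ((x ^ h) ⟨$⟩ʳ i)                     ≡⟨ ^-fold n x g _ ⟩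
        fold ((x ^ h) ⟨$⟩ʳ i) (x ⟨$⟩ʳ_) g                  ≡⟨ cong (λ k → fold k (x ⟨$⟩ʳ_) g) (^-fold n x h i) ⟩
        fold (fold i (x ⟨$⟩ʳ_) h) (x ⟨$⟩ʳ_) g              ≡⟨ fold-+ i (x ⟨$⟩ʳ_) g {h} ⟨
        fold i (x ⟨$⟩ʳ_) (g + h)                            ≡⟨ cong (fold i (x ⟨$⟩ʳ_)) eq ⟩
        x ⟨$⟩ʳ (fold i (x ⟨$⟩ʳ_) (t * N))                  ≡⟨ cong (x ⟨$⟩ʳ_) (xN i (t * N) (n∣m*n t)) ⟩
        x ⟨$⟩ʳ i                                            ∎)
        where open ≡-Reasoning
      q>0 : 0 < q
      q>0 = n≢0⇒n>0 λ { refl → p∤q (p ∣0) }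
      regular : ∃ λ k → HasOrder (x ^ e) k × Coprime k p
      regular =
        let k , ord , k∣q = order (x ^ e) q>0 λ i → trans (fold-^ x e i q) (xN i (q * e)
              (divides u (trans (lemma q (p ^ⁿ a) u) (cong (u *_) (sym N≡)))))
        in k , ord , prime∤⇒coprime pr (λ p∣k → p∤q (∣-trans p∣k k∣q))
        where
        lemma : ∀ q P u → q * (P * u) ≡ u * (P * q)
        lemma = solve-∀
      torsion : ∃ λ b → HasOrder (x ^ f) (p ^ⁿ b)
      torsion =
        let k , ord , k∣P = order (x ^ f) {p ^ⁿ a} (>-nonZero⁻¹ (p ^ⁿ a) {{m^n≢0 p a}}) λ i → trans (fold-^ x f i (p ^ⁿ a))
              (xN i (p ^ⁿ a * f) (divides v (trans (lemma (p ^ⁿ a) q v) (cong (v *_) (sym N≡)))))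
            b , k≡ = ∣p^a⇒≡p^b pr a k∣P
        in b , subst (HasOrder (x ^ f)) k≡ ord
        where
        lemma : ∀ P q v → P * (q * v) ≡ v * (P * q)
        lemma = solve-∀

module _ {m : ℕ} {K : Subset m} {c : Permutation′ (suc m)} (cox : IsCoxeterElement K c) where

  private
    σ = c ⟨$⟩ʳ_
    σ-inj = perm-injective c

  block-preserved : block K PreservedBy c
  block-preserved = from (coxeter-preserves⇔constant _≟_ {c = c} cox) (block-constant K)

  -- The cycle of i stays in its block because block numbers are invariant under c. Conversely the
  -- indicator of the cycle is invariant, hence constant on blocks, so the cycle is the whole block.
  coxeter-period : ∀ i → 0 < blockSize K i × IsPeriod σ i (blockSize K i)
  coxeter-period i = conclude (returns c i)
    where
    same? : Decidable (λ j → block K i ≡ block K j)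
    same? j = block K i ≟ block K j
    conclude : (∃ λ N → 0 < N × N ≤ suc m × fold i σ N ≡ i) → 0 < blockSize K i × IsPeriod σ i (blockSize K i)
    conclude (N , N>0 , _ , e) = found (period σ-inj Fin._≟_ N>0 e)
      where
      found : (∃ λ ℓ → 0 < ℓ × IsPeriod σ i ℓ) → 0 < blockSize K i × IsPeriod σ i (blockSize K i)
      found (ℓ , ℓ>0 , per) = subst (λ ℓ → 0 < ℓ × IsPeriod σ i ℓ) ℓ≡ (ℓ>0 , per)
        where
        open DecMembership Fin._≟_ using (_∈?_)
        cycle : List (Fin (suc m))
        cycle = orbit σ-inj i ℓ
        inCycle : Fin (suc m) → Bool
        inCycle j = does (j ∈? cycle)
        inCycle-preserved : inCycle PreservedBy c
        inCycle-preserved j with j ∈? cycle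
        ... | yes j∈ = dec-true (σ j ∈? cycle) (let k , e = ∈-orbit⁻ σ-inj {ℓ = ℓ} j∈ in
                subst (λ z → σ z ∈ cycle) (sym e) (∈-orbit σ-inj ℓ>0 per (suc k)))
        ... | no j∉  = dec-false (σ j ∈? cycle) (j∉ ∘ orbit-closed⁻ σ-inj ℓ>0 per)
        fwd : ∀ {j} → j ∈ cycle → j ∈ filter same? (allFin (suc m))
        fwd j∈ with k , refl ← ∈-orbit⁻ σ-inj {ℓ = ℓ} j∈ =
          ∈-filter⁺ same? (∈-allFin _) (sym (fold-preserved {f = block K} block-preserved i k))
        bwd : ∀ {j} → j ∈ filter same? (allFin (suc m)) → j ∈ cycle
        bwd {j} j∈ with _ , e ← ∈-filter⁻ same? {xs = allFin (suc m)} j∈ | j ∈? cycle in eq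
        ... | yes j∈c = j∈c
        ... | no  _   = contradiction (trans (trans (sym (dec-true (i ∈? cycle) (∈-orbit σ-inj ℓ>0 per 0)))
            (constant-on-blocks {J = K} {inCycle} (to (coxeter-preserves⇔constant Bool._≟_ {c = c} cox) inCycle-preserved) i j e))
            (cong does eq)) λ ()
        ℓ≡ : ℓ ≡ blockSize K i
        ℓ≡ = trans (sym (length-orbit σ-inj i ℓ)) (trans (↭-length (unique∧set⇒↭ (orbit-! σ-inj per)
          (Unique.filter⁺ same? (Unique.allFin⁺ (suc m))) (mk⇔ fwd bwd))) (countFin-block K (block K i)))

  blockSize≤ : ∀ i → blockSize K i ≤ suc m
  blockSize≤ i = ≤-trans (≤-reflexive (sym (countFin-block K (block K i))))
    (≤-trans (length-filter (λ j → block K i ≟ block K j) (allFin (suc m))) (≤-reflexive (length-tabulate id)))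

  -- Makes (m + 1)! a multiple of all cycle lengths for every subset K, so that a single exponent e
  -- serves both Coxeter elements.
  blockSize∣! : ∀ i → blockSize K i ∣ suc m !
  blockSize∣! i = ∣-trans (k∣k! (proj₁ (coxeter-period i))) (m≤n⇒m!∣n! (blockSize≤ i))
    where
    k∣k! : ∀ {k} → 0 < k → k ∣ k !
    k∣k! {suc k} _ = m∣m*n (k !)

-- Equal columns and conjugate regular parts

module _ {m p : ℕ} (pr : Prime p) {E : List (Subset m)} (reps : IsRepresentatives E)
  {K L : Subset m} {x y : Permutation′ (suc m)} (coxK : IsCoxeterElement K x) (coxL : IsCoxeterElement L y)
  where
  open GroupTheory (symmetricGroup (suc m))

  -- The coefficient at b + 1 stands in the row of the representative of `allBut j` with j = b,
  -- because the first block of that subset has b + 1 points. `subsums-~-extend` supplies the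
  -- remaining coefficients.
  equalColumns⇒subsums~ : EqualColumns p E K L → ∀ b → _~_ p (subsums (blockSizes K) b) (subsums (blockSizes L) b)
  equalColumns⇒subsums~ eq = subsums-~-extend (blockSizes K) (blockSizes L) (blockSizes>0 K) (blockSizes>0 L)
    (sum-blockSizes K) (sum-blockSizes L) maximal
    where
    maximal : ∀ b → b < m → _~_ p (subsums (blockSizes K) (suc b)) (subsums (blockSizes L) (suc b))
    maximal b b<m = viaE (find (IsRepresentatives.exhaustive reps (allBut j)))
      where
      j : Fin m
      j = fromℕ< b<m
      viaE : (∃ λ J → J ∈ E × ConjugateSubsets (allBut j) J) →
        _~_ p (subsums (blockSizes K) (suc b)) (subsums (blockSizes L) (suc b))
      viaE (J , J∈ , conj@(g , _)) = subst₂ (_~_ p) (βJ {z = x} coxK) (βJ {z = y} coxL) (∣∣-∣⇒~ (All.lookup eq J∈))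
        where
        κ : Fin (suc m) → Bool
        κ = initial j ∘ (g ⟨$⟩ˡ_)
        trues-κ : trues κ ≡ suc b
        trues-κ = trans (countFin-permute Bool._≟_ (initial j) (Perm.flip g) true)
          (trans (trues-initial j) (cong suc (Fin.toℕ-fromℕ< b<m)))
        βJ : ∀ {M z} → IsCoxeterElement M z → β J M ≡ subsums (blockSizes M) (suc b)
        βJ {M} {z} cox = trans (β≡fixedColourings Bool._≟_ {c = z} (conjugate-detects {J′ = J} (initial-detects j) conj) cox)
          (trans (fixedColourings-Bool {c = z} cox κ) (cong (subsums (blockSizes M)) trues-κ))

  -- A point is labelled by the p′-part of its block size, which is its cycle length under the e-th
  -- power. The congruent series give equal label counts, so `x ^ e` and `y ^ e` are intertwined.
  subsums~⇒conjugateRegularParts : (∀ b → _~_ p (subsums (blockSizes K) b) (subsums (blockSizes L) b)) → ConjugateRegularParts p x y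
  subsums~⇒conjugateRegularParts sim = x ^ e , y ^ e
    , ^e-isRegularPart pr S x N>0 (torsion {z = x} coxK) , ^e-isRegularPart pr S y N>0 (torsion {z = y} coxL)
    , π , (λ k → trans (π-intertwines (π ⟨$⟩ˡ k)) (cong ((y ^ e) ⟨$⟩ʳ_) (Perm.inverseʳ π)))
    where
    N = suc m !
    N>0 : 0 < N
    N>0 = >-nonZero⁻¹ N {{(suc m) !≢0}}
    S : PrimeSplitting p N
    S = primeSplitting pr N N>0
    open RegularExponent pr S
    torsion : ∀ {M z} → IsCoxeterElement M z → ∀ i k → N ∣ k → fold i (z ⟨$⟩ʳ_) k ≡ i
    torsion {M} {z} cox i k N∣k = from (proj₂ (coxeter-period {c = z} cox i) k) (∣-trans (blockSize∣! {c = z} cox i) N∣k)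
    ρ = regularFactor
    ρ-period : ∀ {M z} → IsCoxeterElement M z → ∀ i → IsPeriod ((z ^ e) ⟨$⟩ʳ_) i (ρ (blockSize M i))
    ρ-period {M} {z} cox i j = mk⇔
      (λ eq → to (∣*e⇔ (blockSize∣! {c = z} cox i) j) (to (per (j * e)) (trans (sym (fold-^ z e i j)) eq)))
      (λ d → trans (fold-^ z e i j) (from (per (j * e)) (from (∣*e⇔ (blockSize∣! {c = z} cox i) j) d)))
      where per = proj₂ (coxeter-period {c = z} cox i)
    ρ-invariant : ∀ {M z} → IsCoxeterElement M z → ∀ i → ρ (blockSize M ((z ^ e) ⟨$⟩ʳ i)) ≡ ρ (blockSize M i)
    ρ-invariant {M} {z} cox i = cong (ρ ∘ at (blockSizes M)) (trans (cong (block M) (^-fold (suc m) z e i))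
      (fold-preserved {f = block M} (block-preserved {c = z} cox) i e))
    ρ>0 : ∀ i → 0 < ρ (blockSize K i)
    ρ>0 i = n≢0⇒n>0 λ ρ≡0 → >⇒≢ (proj₁ (coxeter-period {c = x} coxK i)) (gcd[m,n]≡0⇒m≡0 ρ≡0)
    counts : ∀ c → countFin _≟_ (ρ ∘ blockSize K) c ≡ countFin _≟_ (ρ ∘ blockSize L) c
    counts c = trans (countFin-blockSize K ρ c) (trans
      (subsums-determine-weight pr (blockSizes K) (blockSizes L) (blockSizes>0 K) (blockSizes>0 L) sim _
        (λ a → cong (indicator _≟_ c) (regularFactor-p* a)))
      (sym (countFin-blockSize L ρ c)))
    -- The label is itself the cycle length, hence `id` as the period function.
    matched = intertwiner _≟_ (perm-injective (x ^ e)) (perm-injective (y ^ e)) (ρ ∘ blockSize K) (ρ ∘ blockSize L)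
      (ρ-invariant {z = x} coxK) (ρ-invariant {z = y} coxL) id ρ>0 (ρ-period {z = x} coxK) (ρ-period {z = y} coxL) counts
    π = proj₁ matched
    π-intertwines = proj₁ (proj₂ matched)

  conjugateRegularParts⇒equalColumns : ConjugateRegularParts p x y → EqualColumns p E K L
  conjugateRegularParts⇒equalColumns conj = All.universal equalMod E
    where
    equalMod : ∀ J → EqualMod {m} p (β J K) (β J L)
    equalMod J = ~⇒∣∣-∣ (subst₂ (_~_ p)
      (sym (β≡fixedColourings _≟_ {c = x} (block-detects J) coxK)) (sym (β≡fixedColourings _≟_ {c = y} (block-detects J) coxL))
      (conjugateRegularParts⇒~ (suc m) pr _≟_ {x} {y} conj (block J)))

open GroupTheory using (ConjugateRegularParts)

theorem6 : ∀ (m p : ℕ) → Prime p →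
    (E : List (Subset m)) → IsRepresentatives E →
    (c : Subset m → Permutation′ (suc m)) → (∀ J → IsCoxeterElement J (c J)) →
    ∀ {K L} → K ∈ E → L ∈ F p E →
    d p E K L ≡ 1 ⇔ ConjugateRegularParts (symmetricGroup (suc m)) p (c K) (c L)
theorem6 m p pr E reps c cox {K} {L} _ _ = mk⇔
  (λ d≡1 → subsums~⇒conjugateRegularParts pr reps {x = c K} {c L} (cox K) (cox L)
    (equalColumns⇒subsums~ pr reps {x = c K} {c L} (cox K) (cox L) (decided (equalColumns? p E K L) d≡1)))
  (λ conj → cong (if_then 1 else 0) (dec-true (equalColumns? p E K L)
    (conjugateRegularParts⇒equalColumns pr reps {x = c K} {c L} (cox K) (cox L) conj)))
  where
  decided : ∀ {P : Set} (P? : Dec P) → (if does P? then 1 else 0) ≡ 1 → P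
  decided (yes p) _ = p
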